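{- For any girth $g\ge 8$, there exist two cospectral irregular bipartite graphs $H$ and $H'$ with the same degree sequences and the same girth $g$, but with different numbers of $i$-cycles for any $i\ge g$. Consequently, for irregular bipartite graphs with girth $g\ge 8$, the information of the spectrum and the degree sequences is not sufficient, in general, to determine the multiplicity of $i$-cycles for $i\ge g$.
   Context: All graphs are undirected and simple (no loops or parallel edges), and may be disconnected. The spectrum of a graph is the collection of eigenvalues of its adjacency matrix (with multiplicity); two graphs are cospectral if they have the same spectrum. The degree sequences of a bipartite graph are the two monotonic non-increasing sequences of the node degrees on the two sides of the bipartition. A bipartite graph is bi-regular if all nodes on the same side of the bipartition have the same degree, and irregular if it is not bi-regular. An $i$-cycle is a cycle of length $i$. The girth $g$ of a graph is the length of its shortest cycle(s). All cycles of a bipartite graph have even length, so $g$ and $i$ are understood to be even. -}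

module Defs where

open import Algebra.Bundles using (CommutativeRing)
open import Algebra.Structures using (IsCommutativeRing)
open import Data.Bool.Base using (Bool; true; false; if_then_else_)
import Data.Bool.Properties as Bool
open import Data.Fin.Base using (Fin; toℕ)
open import Data.List.Base using (List; allFin; filter; length; map)
import Data.List.Sort
open import Data.Nat.Base as ℕ using (ℕ; suc)
open import Data.Nat.DivMod using (_mod_)
import Data.Nat.Properties as ℕ
open import Data.Product.Base using (_×_; _,_; proj₁; proj₂; ∃; ∃₂; ∃-syntax)
open import Data.Rational.Base as ℚ using (ℚ; 0ℚ; 1ℚ; ½; ∣_∣; 1/_; Positive)
import Data.Rational.Properties as ℚ
import Data.Rational.Solver as ℚSolver
open import Data.Sum.Base using (_⊎_)
open import Data.Vec.Functional using (Vector)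
open import Function.Base using (_∘_)
open import Function.Bundles using (Inverse; _⇔_; mk⇔; Equivalence)
open import Function.Definitions using (Injective)
open import Level using (Level; 0ℓ; _⊔_)
open import Relation.Binary.Bundles using (Setoid)
open import Relation.Binary.Core using (Rel)
open import Relation.Binary.Definitions using (Symmetric; Irreflexive; Decidable)
import Relation.Binary.Construct.Flip.EqAndOrd as Flip
open import Relation.Binary.PropositionalEquality
  using (_≡_; _≢_; refl; sym; trans; cong; cong₂; subst; setoid)
open import Relation.Nullary.Decidable.Core using (does)
open import Relation.Nullary.Negation.Core using (¬_)

------------------------------------------------------------------------
-- Real numbers: Cauchy sequences of rationals, with equality given by
-- the vanishing of the difference.

IsCauchy : (ℕ → ℚ) → Set
IsCauchy x = ∀ ε → 0ℚ ℚ.< ε →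
  ∃[ N ] (∀ m n → N ℕ.≤ m → N ℕ.≤ n → ∣ x m ℚ.- x n ∣ ℚ.< ε)

record ℝ : Set where
  constructor mkℝ
  field
    seq      : ℕ → ℚ
    isCauchy : IsCauchy seq

open ℝ public

infix 4 _≃_

_≃_ : ℝ → ℝ → Set
x ≃ y = ∀ ε → 0ℚ ℚ.< ε →
  ∃[ N ] (∀ n → N ℕ.≤ n → ∣ seq x n ℚ.- seq y n ∣ ℚ.< ε)

private
  half<  : ∀ {ε} → 0ℚ ℚ.< ε → 0ℚ ℚ.< ½ ℚ.* ε
  half< {ε} 0<ε = subst (ℚ._< ½ ℚ.* ε) (ℚ.*-zeroʳ ½) (ℚ.*-monoʳ-<-pos ½ 0<ε)

  half+half : ∀ ε → ½ ℚ.* ε ℚ.+ ½ ℚ.* ε ≡ ε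
  half+half ε = trans (sym (ℚ.*-distribʳ-+ ε ½ ½)) (ℚ.*-identityˡ ε)

  self-diff : ∀ {a b} → a ≡ b → ∣ a ℚ.- b ∣ ≡ 0ℚ
  self-diff {a} refl = cong ∣_∣ (ℚ.+-inverseʳ a)

  ∣-∣-swap : ∀ a b → ∣ a ℚ.- b ∣ ≡ ∣ b ℚ.- a ∣
  ∣-∣-swap a b = trans (sym (ℚ.∣-p∣≡∣p∣ (a ℚ.- b))) (cong ∣_∣ lemma)
    where
    open ℚSolver.+-*-Solver
    lemma : ℚ.- (a ℚ.- b) ≡ b ℚ.- a
    lemma = solve 2 (λ p q → :- (p :- q) := q :- p) refl a b

  -- |p| < ½ε and |q| < ½ε give |p + q| < ε.
  sum-small : ∀ {p q r ε} → r ≡ p ℚ.+ q →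
    ∣ p ∣ ℚ.< ½ ℚ.* ε → ∣ q ∣ ℚ.< ½ ℚ.* ε → ∣ r ∣ ℚ.< ε
  sum-small {p} {q} {_} {ε} refl p< q< =
    ℚ.≤-<-trans (ℚ.∣p+q∣≤∣p∣+∣q∣ p q)
      (subst (∣ p ∣ ℚ.+ ∣ q ∣ ℚ.<_) (half+half ε) (ℚ.+-mono-< p< q<))

  telescope : ∀ a b c → a ℚ.- c ≡ (a ℚ.- b) ℚ.+ (b ℚ.- c)
  telescope = solve 3 (λ a b c → a :- c := (a :- b) :+ (b :- c)) refl
    where open ℚSolver.+-*-Solver

  add-diff : ∀ a b c d →
    (a ℚ.+ b) ℚ.- (c ℚ.+ d) ≡ (a ℚ.- c) ℚ.+ (b ℚ.- d)
  add-diff = solve 4 (λ a b c d → (a :+ b) :- (c :+ d) := (a :- c) :+ (b :- d)) refl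
    where open ℚSolver.+-*-Solver

  neg-diff : ∀ a b → (ℚ.- a) ℚ.- (ℚ.- b) ≡ b ℚ.- a
  neg-diff = solve 2 (λ a b → (:- a) :- (:- b) := b :- a) refl
    where open ℚSolver.+-*-Solver

  mul-diff : ∀ a b c d →
    a ℚ.* b ℚ.- c ℚ.* d ≡ (a ℚ.- c) ℚ.* b ℚ.+ c ℚ.* (b ℚ.- d)
  mul-diff = solve 4 (λ a b c d →
    a :* b :- c :* d := (a :- c) :* b :+ c :* (b :- d)) refl
    where open ℚSolver.+-*-Solver

  eventuallyBounded : ∀ {x} → IsCauchy x →
    ∃[ B ] ∃[ N ] (0ℚ ℚ.< B × (∀ n → N ℕ.≤ n → ∣ x n ∣ ℚ.< B))
  eventuallyBounded {x} cx with cx 1ℚ (ℚ.positive⁻¹ 1ℚ)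
  ... | N , close = 1ℚ ℚ.+ ∣ x N ∣ , N , B>0 , bound
    where
    B>0 : 0ℚ ℚ.< 1ℚ ℚ.+ ∣ x N ∣
    B>0 = ℚ.+-mono-<-≤ (ℚ.positive⁻¹ 1ℚ) (ℚ.0≤∣p∣ (x N))

    split : ∀ n → x n ≡ (x n ℚ.- x N) ℚ.+ x N
    split n = solve 2 (λ a b → a := (a :- b) :+ b) refl (x n) (x N)
      where open ℚSolver.+-*-Solver

    bound : ∀ n → N ℕ.≤ n → ∣ x n ∣ ℚ.< 1ℚ ℚ.+ ∣ x N ∣
    bound n N≤n = ℚ.≤-<-trans
      (subst (ℚ._≤ ∣ x n ℚ.- x N ∣ ℚ.+ ∣ x N ∣) (cong ∣_∣ (sym (split n)))
        (ℚ.∣p+q∣≤∣p∣+∣q∣ (x n ℚ.- x N) (x N)))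
      (ℚ.+-monoˡ-< ∣ x N ∣ (close n N N≤n ℕ.≤-refl))

  divide : ∀ {B ε} → 0ℚ ℚ.< B → 0ℚ ℚ.< ε →
    ∃[ δ ] (0ℚ ℚ.< δ × δ ℚ.* B ≡ ε)
  divide {B} {ε} 0<B 0<ε = ε ℚ.* (1/ B) , pos , eq
    where
    instance
      B-pos : Positive B
      B-pos = ℚ.positive 0<B
      B-nonZero : ℚ.NonZero B
      B-nonZero = ℚ.pos⇒nonZero B

    pos : 0ℚ ℚ.< ε ℚ.* (1/ B)
    pos = subst (ℚ._< ε ℚ.* (1/ B)) (ℚ.*-zeroˡ (1/ B))
      (ℚ.*-monoˡ-<-pos (1/ B) {{ℚ.1/pos⇒pos B}} 0<ε)

    eq : ε ℚ.* (1/ B) ℚ.* B ≡ ε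
    eq = trans (ℚ.*-assoc ε (1/ B) B)
      (trans (cong (ε ℚ.*_) (ℚ.*-inverseˡ B)) (ℚ.*-identityʳ ε))

  product-small : ∀ {p q δ B ε} → δ ℚ.* B ≡ ε → 0ℚ ℚ.< B →
    ∣ p ∣ ℚ.< δ → ∣ q ∣ ℚ.< B → ∣ p ℚ.* q ∣ ℚ.< ε
  product-small {p} {q} {δ} {B} refl 0<B p< q< =
    subst (ℚ._< δ ℚ.* B) (sym (ℚ.∣p*q∣≡∣p∣*∣q∣ p q))
      (ℚ.≤-<-trans
        (ℚ.*-monoˡ-≤-nonNeg ∣ p ∣ {{ℚ.∣-∣-nonNeg p}} (ℚ.<⇒≤ q<))
        (ℚ.*-monoˡ-<-pos B {{ℚ.positive 0<B}} p<))

  product-diff-small : ∀ {a b c d δ₁ δ₂ B C ε} →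
    0ℚ ℚ.< B → 0ℚ ℚ.< C → δ₁ ℚ.* B ≡ ½ ℚ.* ε → δ₂ ℚ.* C ≡ ½ ℚ.* ε →
    ∣ a ℚ.- c ∣ ℚ.< δ₁ → ∣ b ℚ.- d ∣ ℚ.< δ₂ → ∣ b ∣ ℚ.< B → ∣ c ∣ ℚ.< C →
    ∣ a ℚ.* b ℚ.- c ℚ.* d ∣ ℚ.< ε
  product-diff-small {a} {b} {c} {d} {δ₂ = δ₂} {ε = ε} B>0 C>0 e₁ e₂ ac bd b< c< =
    sum-small (mul-diff a b c d)
      (product-small e₁ B>0 ac b<)
      (subst (λ t → ∣ t ∣ ℚ.< ½ ℚ.* ε) (ℚ.*-comm (b ℚ.- d) c)
        (product-small e₂ C>0 bd c<))

  ⊔-l : ∀ {m n o} → m ℕ.⊔ n ℕ.≤ o → m ℕ.≤ o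
  ⊔-l {m} {n} = ℕ.m⊔n≤o⇒m≤o m n

  ⊔-r : ∀ {m n o} → m ℕ.⊔ n ℕ.≤ o → n ℕ.≤ o
  ⊔-r {m} {n} = ℕ.m⊔n≤o⇒n≤o m n

  ⊔⁴ : ∀ a b c d {o} → (a ℕ.⊔ b) ℕ.⊔ (c ℕ.⊔ d) ℕ.≤ o →
    (a ℕ.≤ o × b ℕ.≤ o) × (c ℕ.≤ o × d ℕ.≤ o)
  ⊔⁴ a b c d p =
    let q = ℕ.m⊔n≤o⇒m≤o (a ℕ.⊔ b) (c ℕ.⊔ d) p
        r = ℕ.m⊔n≤o⇒n≤o (a ℕ.⊔ b) (c ℕ.⊔ d) p
    in (⊔-l q , ⊔-r {a} q) , (⊔-l r , ⊔-r {c} r)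

  ≗⇒≃ : ∀ {x y} → (∀ n → seq x n ≡ seq y n) → x ≃ y
  ≗⇒≃ eq ε 0<ε = 0 , λ n _ → subst (ℚ._< ε) (sym (self-diff (eq n))) 0<ε

infixl 6 _+ℝ_
infixl 7 _*ℝ_
infix  8 -ℝ_

fromℚ : ℚ → ℝ
fromℚ q = mkℝ (λ _ → q) λ ε 0<ε →
  0 , λ _ _ _ _ → subst (ℚ._< ε) (sym (self-diff {q} refl)) 0<ε

0ℝ 1ℝ : ℝ
0ℝ = fromℚ 0ℚ
1ℝ = fromℚ 1ℚ

_+ℝ_ : ℝ → ℝ → ℝ
x +ℝ y = mkℝ (λ n → seq x n ℚ.+ seq y n) λ ε 0<ε →
  let N₁ , f = isCauchy x (½ ℚ.* ε) (half< 0<ε)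
      N₂ , g = isCauchy y (½ ℚ.* ε) (half< 0<ε)
  in N₁ ℕ.⊔ N₂ , λ m n N≤m N≤n →
     sum-small (add-diff (seq x m) (seq y m) (seq x n) (seq y n))
       (f m n (⊔-l N≤m) (⊔-l N≤n)) (g m n (⊔-r N≤m) (⊔-r N≤n))

-ℝ_ : ℝ → ℝ
-ℝ x = mkℝ (λ n → ℚ.- seq x n) λ ε 0<ε →
  let N , f = isCauchy x ε 0<ε
  in N , λ m n N≤m N≤n →
     subst (λ t → ∣ t ∣ ℚ.< ε) (sym (neg-diff (seq x m) (seq x n))) (f n m N≤n N≤m)

_*ℝ_ : ℝ → ℝ → ℝ
x *ℝ y = mkℝ (λ n → seq x n ℚ.* seq y n) λ ε 0<ε →
  let C , M₁ , C>0 , x< = eventuallyBounded (isCauchy x)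
      B , M₂ , B>0 , y< = eventuallyBounded (isCauchy y)
      δ₁ , δ₁>0 , e₁ = divide B>0 (half< 0<ε)
      δ₂ , δ₂>0 , e₂ = divide C>0 (half< 0<ε)
      N₁ , f = isCauchy x δ₁ δ₁>0
      N₂ , g = isCauchy y δ₂ δ₂>0
  in (M₁ ℕ.⊔ M₂) ℕ.⊔ (N₁ ℕ.⊔ N₂) , λ m n N≤m N≤n →
     let (_ , m≥M₂) , (m≥N₁ , m≥N₂) = ⊔⁴ M₁ M₂ N₁ N₂ N≤m
         (n≥M₁ , _) , (n≥N₁ , n≥N₂) = ⊔⁴ M₁ M₂ N₁ N₂ N≤n
     in product-diff-small {seq x m} {seq y m} {seq x n} {seq y n} B>0 C>0 e₁ e₂
          (f m n m≥N₁ n≥N₁) (g m n m≥N₂ n≥N₂) (y< m m≥M₂) (x< n n≥M₁)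

private
  ≃-refl : ∀ {x} → x ≃ x
  ≃-refl {x} = ≗⇒≃ {x} {x} λ _ → refl

  ≃-sym : ∀ {x y} → x ≃ y → y ≃ x
  ≃-sym {x} {y} x≃y ε 0<ε =
    let N , f = x≃y ε 0<ε
    in N , λ n N≤n → subst (ℚ._< ε) (∣-∣-swap (seq x n) (seq y n)) (f n N≤n)

  ≃-trans : ∀ {x y z} → x ≃ y → y ≃ z → x ≃ z
  ≃-trans {x} {y} {z} x≃y y≃z ε 0<ε =
    let N₁ , f = x≃y (½ ℚ.* ε) (half< 0<ε)
        N₂ , g = y≃z (½ ℚ.* ε) (half< 0<ε)
    in N₁ ℕ.⊔ N₂ , λ n N≤n →
       sum-small (telescope (seq x n) (seq y n) (seq z n)) (f n (⊔-l N≤n)) (g n (⊔-r N≤n))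

  +-cong : ∀ {x y u v} → x ≃ y → u ≃ v → (x +ℝ u) ≃ (y +ℝ v)
  +-cong {x} {y} {u} {v} x≃y u≃v ε 0<ε =
    let N₁ , f = x≃y (½ ℚ.* ε) (half< 0<ε)
        N₂ , g = u≃v (½ ℚ.* ε) (half< 0<ε)
    in N₁ ℕ.⊔ N₂ , λ n N≤n →
       sum-small (add-diff (seq x n) (seq u n) (seq y n) (seq v n))
         (f n (⊔-l N≤n)) (g n (⊔-r N≤n))

  neg-cong : ∀ {x y} → x ≃ y → (-ℝ x) ≃ (-ℝ y)
  neg-cong {x} {y} x≃y ε 0<ε =
    let N , f = ≃-sym {x} {y} x≃y ε 0<ε
    in N , λ n N≤n →
       subst (λ t → ∣ t ∣ ℚ.< ε) (sym (neg-diff (seq x n) (seq y n))) (f n N≤n)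

  *-cong : ∀ {x y u v} → x ≃ y → u ≃ v → (x *ℝ u) ≃ (y *ℝ v)
  *-cong {x} {y} {u} {v} x≃y u≃v ε 0<ε =
    let C , M₁ , C>0 , y< = eventuallyBounded (isCauchy y)
        B , M₂ , B>0 , u< = eventuallyBounded (isCauchy u)
        δ₁ , δ₁>0 , e₁ = divide B>0 (half< 0<ε)
        δ₂ , δ₂>0 , e₂ = divide C>0 (half< 0<ε)
        N₁ , f = x≃y δ₁ δ₁>0
        N₂ , g = u≃v δ₂ δ₂>0
    in (M₁ ℕ.⊔ M₂) ℕ.⊔ (N₁ ℕ.⊔ N₂) , λ n N≤n →
       let (n≥M₁ , n≥M₂) , (n≥N₁ , n≥N₂) = ⊔⁴ M₁ M₂ N₁ N₂ N≤n
       in product-diff-small {seq x n} {seq u n} {seq y n} {seq v n} B>0 C>0 e₁ e₂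
            (f n n≥N₁) (g n n≥N₂) (u< n n≥M₂) (y< n n≥M₁)

  +-*-isCommutativeRing : IsCommutativeRing _≃_ _+ℝ_ _*ℝ_ -ℝ_ 0ℝ 1ℝ
  +-*-isCommutativeRing = record
    { isRing = record
      { +-isAbelianGroup = record
        { isGroup = record
          { isMonoid = record
            { isSemigroup = record
              { isMagma = record
                { isEquivalence = record
                  { refl  = λ {x} → ≃-refl {x}
                  ; sym   = λ {x} {y} → ≃-sym {x} {y}
                  ; trans = λ {x} {y} {z} → ≃-trans {x} {y} {z}
                  }
                ; ∙-cong = λ {x} {y} {u} {v} → +-cong {x} {y} {u} {v}
                }
              ; assoc = λ x y z → ≗⇒≃ {(x +ℝ y) +ℝ z} {x +ℝ (y +ℝ z)}
                  λ n → ℚ.+-assoc (seq x n) (seq y n) (seq z n)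
              }
            ; identity =
                (λ x → ≗⇒≃ {0ℝ +ℝ x} {x} λ n → ℚ.+-identityˡ (seq x n))
              , (λ x → ≗⇒≃ {x +ℝ 0ℝ} {x} λ n → ℚ.+-identityʳ (seq x n))
            }
          ; inverse =
              (λ x → ≗⇒≃ {(-ℝ x) +ℝ x} {0ℝ} λ n → ℚ.+-inverseˡ (seq x n))
            , (λ x → ≗⇒≃ {x +ℝ (-ℝ x)} {0ℝ} λ n → ℚ.+-inverseʳ (seq x n))
          ; ⁻¹-cong = λ {x} {y} → neg-cong {x} {y}
          }
        ; comm = λ x y → ≗⇒≃ {x +ℝ y} {y +ℝ x} λ n → ℚ.+-comm (seq x n) (seq y n)
        }
      ; *-cong = λ {x} {y} {u} {v} → *-cong {x} {y} {u} {v}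
      ; *-assoc = λ x y z → ≗⇒≃ {(x *ℝ y) *ℝ z} {x *ℝ (y *ℝ z)}
          λ n → ℚ.*-assoc (seq x n) (seq y n) (seq z n)
      ; *-identity =
          (λ x → ≗⇒≃ {1ℝ *ℝ x} {x} λ n → ℚ.*-identityˡ (seq x n))
        , (λ x → ≗⇒≃ {x *ℝ 1ℝ} {x} λ n → ℚ.*-identityʳ (seq x n))
      ; distrib =
          (λ x y z → ≗⇒≃ {x *ℝ (y +ℝ z)} {(x *ℝ y) +ℝ (x *ℝ z)}
            λ n → ℚ.*-distribˡ-+ (seq x n) (seq y n) (seq z n))
        , (λ x y z → ≗⇒≃ {(y +ℝ z) *ℝ x} {(y *ℝ x) +ℝ (z *ℝ x)}
            λ n → ℚ.*-distribʳ-+ (seq x n) (seq y n) (seq z n))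
      }
    ; *-comm = λ x y → ≗⇒≃ {x *ℝ y} {y *ℝ x} λ n → ℚ.*-comm (seq x n) (seq y n)
    }

ℝ-commutativeRing : CommutativeRing 0ℓ 0ℓ
ℝ-commutativeRing = record { isCommutativeRing = +-*-isCommutativeRing }

------------------------------------------------------------------------
-- Eigenvalues and their multiplicities

module Eigen {c ℓ : Level} (R : CommutativeRing c ℓ) where

  open CommutativeRing R using (Carrier; _≈_; _+_; _*_; 0#; +-monoid)
  open import Algebra.Properties.Monoid.Sum +-monoid using (sum-syntax)

  SquareMatrix : ℕ → Set c
  SquareMatrix n = Fin n → Fin n → Carrier

  infixr 7 _*ᵥ_

  _*ᵥ_ : ∀ {n} → SquareMatrix n → Vector Carrier n → Vector Carrier n
  _*ᵥ_ {n} A v i = ∑[ j < n ] (A i j * v j)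

  InEigenspace : ∀ {n} → SquareMatrix n → Carrier → Vector Carrier n → Set ℓ
  InEigenspace A μ v = ∀ i → (A *ᵥ v) i ≈ μ * v i

  linearCombination : ∀ {k n} →
    Vector Carrier k → Vector (Vector Carrier n) k → Vector Carrier n
  linearCombination {k} a vs i = ∑[ j < k ] (a j * vs j i)

  -- The μ-eigenspace of A has dimension k; in particular μ is not an
  -- eigenvalue precisely when k = 0.  This is used for real symmetric
  -- matrices only, where geometric and algebraic multiplicity agree.
  record HasMultiplicity {n : ℕ} (A : SquareMatrix n) (μ : Carrier) (k : ℕ)
                         : Set (c ⊔ ℓ) where
    field
      basis       : Vector (Vector Carrier n) k
      eigen       : ∀ j → InEigenspace A μ (basis j)
      independent : ∀ a → (∀ i → linearCombination a basis i ≈ 0#) →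
                    ∀ j → a j ≈ 0#
      spanning    : ∀ v → InEigenspace A μ v →
                    ∃[ a ] (∀ i → v i ≈ linearCombination a basis i)

open Eigen ℝ-commutativeRing public using (SquareMatrix; HasMultiplicity)

------------------------------------------------------------------------
-- Graphs

record Graph : Set₁ where
  infix 4 _~_ _~?_
  field
    order    : ℕ
    _~_      : Rel (Fin order) 0ℓ
    ~-sym    : Symmetric _~_
    ~-irrefl : Irreflexive _≡_ _~_
    _~?_     : Decidable _~_

  Vertex : Set
  Vertex = Fin order

  degree : Vertex → ℕ
  degree v = length (filter (v ~?_) (allFin order))

  adjacencyMatrix : SquareMatrix order
  adjacencyMatrix u v = if does (u ~? v) then 1ℝ else 0ℝ

Cospectral : Graph → Graph → Set
Cospectral G G′ = ∀ (μ : ℝ) (k : ℕ) →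
  HasMultiplicity (Graph.adjacencyMatrix G) μ k ⇔
  HasMultiplicity (Graph.adjacencyMatrix G′) μ k

------------------------------------------------------------------------
-- Cycles

next : ∀ {i} → Fin i → Fin i
next {suc i} j = suc (toℕ j) mod suc i

-- A cyclic listing of the vertices of an i-cycle.
record Cycle (G : Graph) (i : ℕ) : Set where
  open Graph G
  field
    length≥3  : 3 ℕ.≤ i
    vertex    : Fin i → Vertex
    injective : Injective _≡_ _≡_ vertex
    adjacent  : ∀ j → vertex j ~ vertex (next j)

  HasEdge : Vertex → Vertex → Set
  HasEdge u v = ∃[ j ] ((u ≡ vertex j × v ≡ vertex (next j)) ⊎
                        (v ≡ vertex j × u ≡ vertex (next j)))

-- Cycles are counted as subgraphs: listings that differ by the starting
-- vertex or by the direction of traversal have the same edges and are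
-- identified.
cycleSetoid : Graph → ℕ → Setoid 0ℓ 0ℓ
cycleSetoid G i = record
  { Carrier       = Cycle G i
  ; _≈_           = λ C D → ∀ u v → Cycle.HasEdge C u v ⇔ Cycle.HasEdge D u v
  ; isEquivalence = record
    { refl  = λ u v → mk⇔ (λ e → e) (λ e → e)
    ; sym   = λ p u v → mk⇔ (Equivalence.from (p u v)) (Equivalence.to (p u v))
    ; trans = λ p q u v → mk⇔ (Equivalence.to (q u v) ∘ Equivalence.to (p u v))
                              (Equivalence.from (p u v) ∘ Equivalence.from (q u v))
    }
  }

HasCycleCount : Graph → ℕ → ℕ → Set
HasCycleCount G i N = Inverse (cycleSetoid G i) (setoid (Fin N))

DifferentCycleCounts : Graph → Graph → ℕ → Set
DifferentCycleCounts G G′ i =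
  ∃₂ λ N N′ → HasCycleCount G i N × HasCycleCount G′ i N′ × N ≢ N′

HasGirth : Graph → ℕ → Set
HasGirth G g = Cycle G g × (∀ i → Cycle G i → g ℕ.≤ i)

------------------------------------------------------------------------
-- Bipartite graphs

-- The bipartition is part of the data, since a disconnected graph may
-- have several.
record BipartiteGraph : Set₁ where
  field
    graph  : Graph
  open Graph graph public
  field
    side   : Vertex → Bool
    proper : ∀ {u v} → u ~ v → side u ≢ side v

open BipartiteGraph public using (graph)

open Data.List.Sort (Flip.decTotalOrder ℕ.≤-decTotalOrder)
  renaming (sort to sortNonIncreasing) using ()

degreeSequence : BipartiteGraph → Bool → List ℕ
degreeSequence B s =
  sortNonIncreasing (map degree (filter (λ v → side v Bool.≟ s) (allFin order)))
  where open BipartiteGraph B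

SameDegreeSequences : BipartiteGraph → BipartiteGraph → Set
SameDegreeSequences B B′ = ∀ s → degreeSequence B s ≡ degreeSequence B′ s

BiRegular : BipartiteGraph → Set
BiRegular B = ∀ u v → side u ≡ side v → degree u ≡ degree v
  where open BipartiteGraph B

Irregular : BipartiteGraph → Set
Irregular B = ¬ BiRegular B

-- On irregular bipartite graphs of girth g, the number of i-cycles is a
-- function of the spectrum and the degree sequences.
CycleCountDetermined : ℕ → ℕ → Set₁
CycleCountDetermined g i = ∀ (B B′ : BipartiteGraph) →
  Irregular B → Irregular B′ →
  HasGirth (graph B) g → HasGirth (graph B′) g →
  Cospectral (graph B) (graph B′) → SameDegreeSequences B B′ →
  ∀ {N N′} → HasCycleCount (graph B) i N → HasCycleCount (graph B′) i N′ → N ≡ N′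

{-# OPTIONS --safe #-}

-- Every component of the graphs below has at most as many edges as nodes:
-- orient each edge from child to parent, or around the cycle.  A node has at
-- most one outgoing edge, so every cycle is consistently oriented and two
-- cycles sharing a node coincide; hence the cycles are exactly the cyclic
-- components.  With D̃(ℓ) the path on ℓ nodes with two extra leaves at both
-- ends, the spectrum of C(2ℓ+2) ∪ 2K₁ is that of D̃(ℓ) ∪ P(ℓ), so
-- C(2ℓ+2) ∪ D̃(m) ∪ P(m) and C(2m+2) ∪ D̃(ℓ) ∪ P(ℓ) are cospectral.  Take
-- m = ℓ + 2, for which the degrees on both sides agree, choose i = 2ℓ + 2, and
-- add a cycle of length g to both: the second graph has one i-cycle fewer.

module Submission where

open import Algebra.Bundles using (CommutativeRing)
open import Defs
open import Data.Bool.Base using (Bool; true; false; not; if_then_else_)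
import Data.Bool.Properties as Bool
open import Data.Bool.Properties using (not-¬; not-involutive)
open import Data.Empty using (⊥; ⊥-elim)
open import Data.Fin.Base using (Fin; zero; suc; toℕ; fromℕ; fromℕ<; inject₁)
open import Data.Fin.Induction
  using (<-weakInduction; <-weakInduction-startingFrom; >-weakInduction)
open import Data.Fin.Patterns using (0F; 1F; 2F; 3F)
import Data.Fin.Properties as Fin
open import Data.Fin.Relation.Unary.Top using (view; ‵fromℕ; ‵inject₁)
open import Data.List.Base
  using (List; []; _∷_; [_]; _++_; map; foldr; filter; length; allFin; tabulate)
import Data.List.Membership.DecPropositional as DecMembership
open import Data.List.Membership.Propositional using (_∈_)
open import Data.List.Membership.Propositional.Properties
  using (∈-map⁺; ∈-map⁻; ∈-++⁺ʳ; ∈-++⁻; ∈-filter⁺; ∈-filter⁻; ∈-allFin)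
open import Data.List.Membership.Propositional.Properties.WithK using (unique∧set⇒bag)
open import Data.List.Properties using (length-map; map-cong; filter-≐)
open import Data.List.Relation.Binary.BagAndSetEquality using (∼bag⇒↭)
open import Data.List.Relation.Binary.Permutation.Propositional as Perm using (_↭_; prep; swap)
open import Data.List.Relation.Binary.Permutation.Propositional.Properties using (↭-length)
open import Data.List.Relation.Unary.All using ([]; _∷_)
open import Data.List.Relation.Unary.AllPairs using ([]; _∷_)
open import Data.List.Relation.Unary.Any using (here; there)
open import Data.List.Relation.Unary.Unique.Propositional using (Unique)
import Data.List.Relation.Unary.Unique.Propositional.Properties as Unique
import Data.List.Sort
open import Data.Maybe.Base as Maybe using (Maybe; just; nothing; maybe′)
open import Data.Maybe.Properties using (just-injective)
open import Data.Nat.Base as ℕ using (ℕ; zero; suc; _≤_; _<_; z≤n; s≤s)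
open import Data.Nat.Divisibility using (_∣_; divides)
open import Data.Nat.DivMod using (m<n⇒m%n≡m; n%n≡0)
open import Data.Nat.GeneralisedArithmetic using (fold)
import Data.Nat.Properties as ℕ
open import Data.Product.Base using (_×_; _,_; proj₁; proj₂; ∃; ∃-syntax; Σ-syntax; map₂)
open import Data.Rational.Base as ℚ using (ℚ; 0ℚ; 1ℚ; ½)
import Data.Rational.Properties as ℚ
import Data.Rational.Solver as ℚSolver
open import Data.Sum.Base as Sum using (_⊎_; inj₁; inj₂; [_,_]′)
open import Data.Sum.Function.Propositional using (_⊎-↔_)
open import Data.Sum.Properties using (inj₁-injective; inj₂-injective)
open import Data.Sum.Relation.Binary.Pointwise using (Pointwise; inj₁; inj₂)
open import Data.Vec.Functional using (Vector)
open import Function.Base using (_∘_; id; case_of_)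
open import Function.Bundles using (Inverse; _↔_; _⇔_; mk↔ₛ′; mk⇔; Equivalence)
open import Function.Properties.Inverse using (↔-refl; ↔-sym; ↔-trans)
open import Level using (Level; 0ℓ; _⊔_)
import Relation.Binary.Construct.Flip.EqAndOrd as Flip
open import Relation.Binary.Core using (Rel)
open import Relation.Binary.Definitions using (DecidableEquality)
open import Relation.Binary.PropositionalEquality as ≡
  using (_≡_; _≢_; refl; sym; trans; cong; cong₂; subst; subst₂)
open import Relation.Nullary.Decidable.Core using (does; yes; no)
open import Relation.Nullary.Negation.Core using (¬_)
open import Relation.Unary using (Pred; Decidable)

-- Multiplicity is defined by bases of eigenspaces over Cauchy reals, where equality is undecidable
-- and ranks cannot be computed. Cospectrality is therefore not derived from characteristic
-- polynomials but from an explicit invertible matrix intertwining the two adjacency matrices, which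
-- carries an eigenbasis over for every eigenvalue at once. Its entries are rational, so all
-- identities about it can be checked in ℚ.
--
-- The nodes 2K₁ need not be present: they correspond to the differences of twin leaves, which the
-- adjacency matrix of D̃ kills. Both unions contain one tree, hence two such differences, and the
-- matrix passes these on unchanged.
--
-- The lengths differ by two because an odd difference would put one end of the spine, with its two
-- leaves, on the other side of the bipartition. The shortest usable spine has two nodes, since a
-- single spine node would have degree 4 instead of two nodes having degree 3; so every even i from
-- 6 on is reached.

-- The cyclic successor.

toℕ-next : ∀ {n} (j : Fin (suc n)) → toℕ (next j) ≡ suc (toℕ j) ℕ.% suc n
toℕ-next j = Fin.toℕ-fromℕ< _

toℕ-next-< : ∀ {n} (j : Fin n) → suc (toℕ j) < n → toℕ (next j) ≡ suc (toℕ j)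
toℕ-next-< {suc _} j 1+j<n = trans (toℕ-next j) (m<n⇒m%n≡m 1+j<n)

toℕ-next-≡ : ∀ {n} (j : Fin n) → suc (toℕ j) ≡ n → toℕ (next j) ≡ 0
toℕ-next-≡ {suc n} j 1+j≡n =
  trans (toℕ-next j) (trans (cong (ℕ._% suc n) 1+j≡n) (n%n≡0 (suc n)))

next-inject₁ : ∀ {n} (j : Fin n) → next (inject₁ j) ≡ suc j
next-inject₁ j = Fin.toℕ-injective (trans
  (toℕ-next-< (inject₁ j) (s≤s (subst (_< _) (sym (Fin.toℕ-inject₁ j)) (Fin.toℕ<n j))))
  (cong suc (Fin.toℕ-inject₁ j)))

next-fromℕ : ∀ n → next (fromℕ n) ≡ zero
next-fromℕ n = Fin.toℕ-injective (toℕ-next-≡ (fromℕ n) (cong suc (Fin.toℕ-fromℕ n)))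

next-cases : ∀ {n} (j : Fin n) →
  toℕ (next j) ≡ suc (toℕ j) ⊎ (suc (toℕ j) ≡ n × toℕ (next j) ≡ 0)
next-cases j with ℕ.m≤n⇒m<n∨m≡n (Fin.toℕ<n j)
... | inj₁ 1+j<n = inj₁ (toℕ-next-< j 1+j<n)
... | inj₂ 1+j≡n = inj₂ (1+j≡n , toℕ-next-≡ j 1+j≡n)

-- A return after two steps forces n to be at most 2. Hence the two neighbours of a vertex along a
-- cycle are different vertices.
next²≢id : ∀ {n} → 3 ≤ n → (j : Fin n) → next (next j) ≢ j
next²≢id 3≤n j eq = go (cong toℕ eq) 3≤n (next-cases j) (next-cases (next j))
  where
  go : ∀ {n t t′ t″} → t″ ≡ t → 3 ≤ n →
    t′ ≡ suc t ⊎ (suc t ≡ n × t′ ≡ 0) → t″ ≡ suc t′ ⊎ (suc t′ ≡ n × t″ ≡ 0) → ⊥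
  go refl _  (inj₁ refl) (inj₁ ())
  go refl (s≤s (s≤s ())) (inj₁ refl) (inj₂ (refl , refl))
  go refl (s≤s (s≤s ())) (inj₂ (refl , refl)) (inj₁ refl)

-- The property climbs from `j` to the last index, wraps around to `zero`, and from there reaches
-- everything by ordinary induction.
rotate : ∀ {n} (P : Fin n → Set) → (∀ j → P j → P (next j)) → ∀ {j} → P j → ∀ k → P k
rotate {suc n} P step {j} Pj = <-weakInduction P P₀ up
  where
  up : ∀ i → P (inject₁ i) → P (suc i)
  up i = subst P (next-inject₁ i) ∘ step (inject₁ i)

  P₀ : P zero
  P₀ = subst P (next-fromℕ n)
    (step (fromℕ n) (<-weakInduction-startingFrom P Pj up (Fin.≤fromℕ j)))

-- Propagation against the direction of `next` is propagation along it for the predicate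
-- `P l → P k`, which holds trivially at `l = k`.
rotate⁻ : ∀ {n} (P : Fin n → Set) → (∀ j → P (next j) → P j) → ∀ {j} → P j → ∀ k → P k
rotate⁻ P step Pj k = rotate (λ l → P l → P k) (λ l f → f ∘ step l) (λ p → p) _ Pj

-- Cycles in pseudoforests

module Oriented (G : Graph)
  (_⟶_ : Rel (Graph.Vertex G) 0ℓ)
  (functional : ∀ {u v w} → u ⟶ v → u ⟶ w → v ≡ w)
  (orient : ∀ {u v} → Graph._~_ G u v → u ⟶ v ⊎ v ⟶ u)
  where

  open Graph G
  open Cycle

  data Direction {i} (C : Cycle G i) : Set where
    forward  : (∀ j → vertex C j ⟶ vertex C (next j)) → Direction C
    backward : (∀ j → vertex C (next j) ⟶ vertex C j) → Direction C

  -- Two consecutive edges of a cycle cannot both point away from their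
  -- common vertex, so a backward edge is followed by a backward edge.
  direction : ∀ {i} (C : Cycle G i) → Direction C
  direction {suc i} C with orient (adjacent C zero)
  ... | inj₂ b = backward (rotate _ follow b)
    where
    follow : ∀ j → vertex C (next j) ⟶ vertex C j →
      vertex C (next (next j)) ⟶ vertex C (next j)
    follow j b with orient (adjacent C (next j))
    ... | inj₁ f  = ⊥-elim (next²≢id (length≥3 C) j (injective C (functional f b)))
    ... | inj₂ b′ = b′
  ... | inj₁ f = forward (rotate⁻ _ precede f)
    where
    precede : ∀ j → vertex C (next j) ⟶ vertex C (next (next j)) →
      vertex C j ⟶ vertex C (next j)
    precede j f with orient (adjacent C j)
    ... | inj₁ f′ = f′
    ... | inj₂ b  = ⊥-elim (next²≢id (length≥3 C) j (injective C (functional f b)))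

  _∈ᶜ_ : ∀ {i} → Vertex → Cycle G i → Set
  v ∈ᶜ C = ∃[ j ] v ≡ vertex C j

  _⊆ᶜ_ : ∀ {i k} → Cycle G i → Cycle G k → Set
  C ⊆ᶜ D = ∀ j → vertex C j ∈ᶜ D

  previous : ∀ {n} (j : Fin n) → ∃[ k ] next k ≡ j
  previous {n} j = rotate (λ j → ∃[ k ] next k ≡ j) (λ j _ → j , refl) {next j} (j , refl) j

  -- At each of its vertices a consistently oriented cycle already uses an outgoing arc, and there
  -- is only one.
  ⟶⇒HasEdge : ∀ {i} (C : Cycle G i) {u v} → u ∈ᶜ C → u ⟶ v → HasEdge C u v
  ⟶⇒HasEdge C (j , refl) u⟶v with direction C
  ... | forward  f = j , inj₁ (refl , functional u⟶v (f j))
  ... | backward b with previous j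
  ...   | k , refl = k , inj₂ (functional u⟶v (b k) , refl)

  HasEdge-sym : ∀ {i} (C : Cycle G i) {u v} → HasEdge C u v → HasEdge C v u
  HasEdge-sym C (j , inj₁ e) = j , inj₂ e
  HasEdge-sym C (j , inj₂ e) = j , inj₁ e

  HasEdge⇒∈ : ∀ {i} (C : Cycle G i) {u v} → HasEdge C u v → u ∈ᶜ C
  HasEdge⇒∈ C (j , inj₁ (u≡ , _)) = j , u≡
  HasEdge⇒∈ C (j , inj₂ (_ , u≡)) = next j , u≡

  HasEdge⇒~ : ∀ {i} (C : Cycle G i) {u v} → HasEdge C u v → u ~ v
  HasEdge⇒~ C (j , inj₁ (refl , refl)) = adjacent C j
  HasEdge⇒~ C (j , inj₂ (refl , refl)) = ~-sym (adjacent C j)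

  -- Following `C` along its orientation from a common vertex never leaves `D`, because `D` contains
  -- the unique outgoing arc of each of its vertices.
  meet⇒⊆ : ∀ {i k} (C : Cycle G i) (D : Cycle G k) {v} → v ∈ᶜ C → v ∈ᶜ D → C ⊆ᶜ D
  meet⇒⊆ C D (j , refl) v∈D with direction C
  ... | forward  f = rotate (λ j → vertex C j ∈ᶜ D)
    (λ j ∈D → HasEdge⇒∈ D (HasEdge-sym D (⟶⇒HasEdge D ∈D (f j)))) v∈D
  ... | backward b = rotate⁻ (λ j → vertex C j ∈ᶜ D)
    (λ j ∈D → HasEdge⇒∈ D (HasEdge-sym D (⟶⇒HasEdge D ∈D (b j)))) v∈D

  onBoth : ∀ {i k} (C : Cycle G i) (D : Cycle G k) {v w} →
    v ∈ᶜ C → v ∈ᶜ D → w ∈ᶜ C → w ∈ᶜ D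
  onBoth C D v∈C v∈D (j , refl) = meet⇒⊆ C D v∈C v∈D j

  ⊆⇒≤ : ∀ {i k} (C : Cycle G i) (D : Cycle G k) → C ⊆ᶜ D → i ≤ k
  ⊆⇒≤ C D C⊆D = Fin.injective⇒≤ {f = proj₁ ∘ C⊆D} λ {x} {y} eq → injective C
    (trans (proj₂ (C⊆D x)) (trans (cong (vertex D) eq) (sym (proj₂ (C⊆D y)))))

  meet⇒≡length : ∀ {i k} (C : Cycle G i) (D : Cycle G k) {v} → v ∈ᶜ C → v ∈ᶜ D → i ≡ k
  meet⇒≡length C D v∈C v∈D = ℕ.≤-antisym
    (⊆⇒≤ C D (meet⇒⊆ C D v∈C v∈D)) (⊆⇒≤ D C (meet⇒⊆ D C v∈D v∈C))

  ⊆⇒HasEdge : ∀ {i k} (C : Cycle G i) (D : Cycle G k) → C ⊆ᶜ D →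
    ∀ u v → HasEdge C u v → HasEdge D u v
  ⊆⇒HasEdge C D C⊆D u v e with orient (HasEdge⇒~ C e)
  ... | inj₁ u⟶v with HasEdge⇒∈ C e
  ...   | j , refl = ⟶⇒HasEdge D (C⊆D j) u⟶v
  ⊆⇒HasEdge C D C⊆D u v e | inj₂ v⟶u with HasEdge⇒∈ C (HasEdge-sym C e)
  ...   | j , refl = HasEdge-sym D (⟶⇒HasEdge D (C⊆D j) v⟶u)

  meet⇒≈ : ∀ {i} (C D : Cycle G i) {v} → v ∈ᶜ C → v ∈ᶜ D →
    ∀ u v → HasEdge C u v ⇔ HasEdge D u v
  meet⇒≈ C D v∈C v∈D u v = mk⇔
    (⊆⇒HasEdge C D (meet⇒⊆ C D v∈C v∈D) u v) (⊆⇒HasEdge D C (meet⇒⊆ D C v∈D v∈C) u v)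

  -- A cycle through a vertex of T would descend in rank forever.
  acyclic : (T : Vertex → Set) (rank : Vertex → ℕ) →
    (∀ {u v} → u ~ v → T u → T v) → (∀ {u v} → T u → u ⟶ v → rank v < rank u) →
    ∀ {i} (C : Cycle G i) j → T (vertex C j) → ⊥
  acyclic T rank T-closed descent C j t with direction C
  ... | forward  f = ℕ.<-irrefl refl (rotate (λ k → rank (vertex C k) < rank (vertex C j))
    (λ k → ℕ.<-trans (descent (onT k) (f k))) (descent t (f j)) j)
    where
    onT = rotate (T ∘ vertex C) (λ k → T-closed (adjacent C k)) t
  ... | backward b = ℕ.<-irrefl refl (rotate (λ k → rank (vertex C j) < rank (vertex C k))
    (λ k p → ℕ.<-trans p (descent (onT (next k)) (b k))) (descent (onT (next j)) (b j)) j)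
    where
    onT = rotate (T ∘ vertex C) (λ k → T-closed (adjacent C k)) t

  module Count {I : Set} (L : I → ℕ) (ring : ∀ ι → Cycle G (L ι))
    (disjoint : ∀ {ι κ v} → v ∈ᶜ ring ι → v ∈ᶜ ring κ → ι ≡ κ)
    (covered : ∀ {i} (C : Cycle G i) j → ∃[ ι ] (vertex C j ∈ᶜ ring ι))
    where

    locate : ∀ {i} (C : Cycle G i) → ∃[ ι ] ∃[ v ] (v ∈ᶜ C × v ∈ᶜ ring ι)
    locate {zero}  C with () ← length≥3 C
    locate {suc i} C = let ι , p = covered C zero in ι , vertex C zero , (zero , refl) , p

    length≡ : ∀ {i} (C : Cycle G i) → ∃[ ι ] L ι ≡ i
    length≡ C = let ι , v , v∈C , v∈ring = locate C
                in ι , meet⇒≡length (ring ι) C v∈ring v∈C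

    ringOf : ∀ {i} → (∃[ ι ] L ι ≡ i) → Cycle G i
    ringOf (ι , refl) = ring ι

    -- `length≡` inspects the vertex at index `zero`, which depends on the listing. Disjointness of
    -- the rings removes this dependence: any common vertex determines the ring.
    length≡-unique : ∀ {i} (C : Cycle G i) (p : ∃[ ι ] L ι ≡ i) {v} →
      v ∈ᶜ C → v ∈ᶜ ringOf p → length≡ C ≡ p
    length≡-unique C (κ , refl) v∈C v∈κ =
      let ι , w , w∈C , w∈ι = locate C in
      pair (disjoint w∈ι (onBoth C (ring κ) v∈C v∈κ w∈C))
      where
      pair : ∀ {i} {p q : ∃[ ι ] L ι ≡ i} → proj₁ p ≡ proj₁ q → p ≡ q
      pair {p = ι , a} {q = .ι , b} refl = cong (ι ,_) (ℕ.≡-irrelevant a b)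

    ringOf-length≡ : ∀ {i} (C : Cycle G i) → ∃[ v ] (v ∈ᶜ C × v ∈ᶜ ringOf (length≡ C))
    ringOf-length≡ C = let ι , v , v∈C , v∈ι = locate C
                       in v , v∈C , onRing (proj₂ (length≡ C)) v∈ι
      where
      onRing : ∀ {ι i v} (eq : L ι ≡ i) → v ∈ᶜ ring ι → v ∈ᶜ ringOf (ι , eq)
      onRing refl v∈ι = v∈ι

    common : ∀ {i} (C D : Cycle G i) → (∀ u v → HasEdge C u v ⇔ HasEdge D u v) →
      ∃[ v ] (v ∈ᶜ C × v ∈ᶜ D)
    common {zero}  C D C≈D with () ← length≥3 C
    common {suc i} C D C≈D = vertex C zero , (zero , refl) ,
      HasEdge⇒∈ D (Equivalence.to (C≈D _ _) (zero , inj₁ (refl , refl)))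

    -- Each cycle meets exactly one ring and then has the same edges as that ring. So i-cycles up to
    -- edge equality amount to solutions ι of `L ι ≡ i`, and counting cycles becomes counting these.
    cycleCount : ∀ {i N} → (∃[ ι ] L ι ≡ i) ↔ Fin N → HasCycleCount G i N
    cycleCount {i} lengths = record
      { to        = to ∘ length≡
      ; from      = ringOf ∘ from
      ; to-cong   = λ {C} {D} C≈D →
          let v , v∈C , v∈D = common C D C≈D
              w , w∈D , w∈ring = ringOf-length≡ D
          in cong to (length≡-unique C (length≡ D) v∈C
               (onBoth D (ringOf (length≡ D)) w∈D w∈ring v∈D))
      ; from-cong = λ { refl u v → mk⇔ (λ e → e) (λ e → e) }
      ; inverse   =
          (λ {k} {C} C≈ → let v , v∈C , v∈ring = common C (ringOf (from k)) C≈ in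
            trans (cong to (length≡-unique C (from k) v∈C v∈ring)) (strictlyInverseˡ k))
        , (λ { {C} refl → let v , v∈C , v∈ring = ringOf-length≡ C in
            meet⇒≈ (ringOf (from (to (length≡ C)))) C
              (subst (λ p → v ∈ᶜ ringOf p) (sym (strictlyInverseʳ (length≡ C))) v∈ring) v∈C })
      }
      where
      open Inverse lengths

-- Pseudoforests

-- Two descriptions of the same edges are kept in step: arcs, at most one leaving each node, serve
-- to find cycles; duplicate-free neighbour lists serve for degrees and for the action of the
-- adjacency matrix.
record Pseudoforest : Set₁ where
  infix 4 _⟶_
  field
    Node         : Set
    _⟶_          : Rel Node 0ℓ
    functional   : ∀ {u v w} → u ⟶ v → u ⟶ w → v ≡ w
    neighbours   : Node → List Node
    distinct     : ∀ u → Unique (neighbours u)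
    ⟶⇒∈          : ∀ {u v} → u ⟶ v → v ∈ neighbours u
    ⟵⇒∈          : ∀ {u v} → u ⟶ v → u ∈ neighbours v
    ∈⇒⟶          : ∀ u {v} → v ∈ neighbours u → u ⟶ v ⊎ v ⟶ u
    side         : Node → Bool
    alternating  : ∀ {u v} → u ⟶ v → side v ≡ not (side u)

open Pseudoforest using (Node; neighbours; side)

module _ (F : Pseudoforest) where
  open Pseudoforest F renaming (side to sideᴺ)

  sides≢ : ∀ u {v} → v ∈ neighbours F u → sideᴺ u ≢ sideᴺ v
  sides≢ u v∈ eq with ∈⇒⟶ u v∈
  ... | inj₁ u⟶v = not-¬ (sym eq) (alternating u⟶v)
  ... | inj₂ v⟶u = not-¬ eq (alternating v⟶u)

  module Realise {N : ℕ} (enum : Fin N ↔ Node F) where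
    open Inverse enum renaming (to to name; from to index) public

    name-injective : ∀ {i j} → name i ≡ name j → i ≡ j
    name-injective {i} {j} eq =
      trans (sym (strictlyInverseʳ i)) (trans (cong index eq) (strictlyInverseʳ j))

    index-injective : ∀ {u v} → index u ≡ index v → u ≡ v
    index-injective {u} {v} eq =
      trans (sym (strictlyInverseˡ u)) (trans (cong name eq) (strictlyInverseˡ v))

    _≟ᴺ_ : DecidableEquality (Node F)
    u ≟ᴺ v with index u Fin.≟ index v
    ... | yes eq = yes (index-injective eq)
    ... | no neq = no (neq ∘ cong index)

    G : Graph
    G = record
      { order    = N
      ; _~_      = λ i j → name j ∈ neighbours F (name i)
      ; ~-sym    = λ {i} → [ ⟵⇒∈ , ⟶⇒∈ ]′ ∘ ∈⇒⟶ (name i)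
      ; ~-irrefl = λ { {i} refl i∈ → sides≢ (name i) i∈ refl }
      ; _~?_     = λ i j → DecMembership._∈?_ _≟ᴺ_ (name j) (neighbours F (name i))
      }

    B : BipartiteGraph
    B = record
      { graph  = G
      ; side   = sideᴺ ∘ name
      ; proper = λ {i} → sides≢ (name i)
      }

    open Graph G using (_~?_; degree)

    -- Both lists are duplicate-free and have the same members. Permutation suffices, since degrees
    -- and matrix products ignore the order.
    filter-neighbours : ∀ i → filter (i ~?_) (allFin N) ↭ map index (neighbours F (name i))
    filter-neighbours i = ∼bag⇒↭ (unique∧set⇒bag
      (Unique.filter⁺ (i ~?_) (Unique.allFin⁺ N))
      (Unique.map⁺ index-injective (distinct (name i)))
      (mk⇔ there′ back))
      where
      there′ : ∀ {j} → j ∈ filter (i ~?_) (allFin N) → j ∈ map index (neighbours F (name i))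
      there′ {j} j∈ = subst (_∈ map index (neighbours F (name i))) (strictlyInverseʳ j)
        (∈-map⁺ index (proj₂ (∈-filter⁻ (i ~?_) {xs = allFin N} j∈)))

      back : ∀ {j} → j ∈ map index (neighbours F (name i)) → j ∈ filter (i ~?_) (allFin N)
      back j∈ with ∈-map⁻ index j∈
      ... | v , v∈ , refl = ∈-filter⁺ (i ~?_) (∈-allFin (index v))
        (subst (_∈ neighbours F (name i)) (sym (strictlyInverseˡ v)) v∈)

    degree≡ : ∀ i → degree i ≡ length (neighbours F (name i))
    degree≡ i = trans (↭-length (filter-neighbours i)) (length-map index (neighbours F (name i)))

infixr 5 _⊎ᶠ_

_⊎ᶠ_ : Pseudoforest → Pseudoforest → Pseudoforest
F ⊎ᶠ F′ = record
  { Node        = Node F ⊎ Node F′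
  ; _⟶_         = Pointwise F._⟶_ F′._⟶_
  ; functional  = λ { (inj₁ p) (inj₁ q) → cong inj₁ (F.functional p q)
                    ; (inj₂ p) (inj₂ q) → cong inj₂ (F′.functional p q) }
  ; neighbours  = nbrs
  ; distinct    = λ { (inj₁ u) → Unique.map⁺ inj₁-injective (F.distinct u)
                    ; (inj₂ u) → Unique.map⁺ inj₂-injective (F′.distinct u) }
  ; ⟶⇒∈         = λ { (inj₁ p) → ∈-map⁺ inj₁ (F.⟶⇒∈ p) ; (inj₂ p) → ∈-map⁺ inj₂ (F′.⟶⇒∈ p) }
  ; ⟵⇒∈         = λ { (inj₁ p) → ∈-map⁺ inj₁ (F.⟵⇒∈ p) ; (inj₂ p) → ∈-map⁺ inj₂ (F′.⟵⇒∈ p) }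
  ; ∈⇒⟶         = arc
  ; side        = [ F.side , F′.side ]′
  ; alternating = λ { (inj₁ p) → F.alternating p ; (inj₂ p) → F′.alternating p }
  }
  where
  module F  = Pseudoforest F
  module F′ = Pseudoforest F′

  nbrs : Node F ⊎ Node F′ → List (Node F ⊎ Node F′)
  nbrs = [ map inj₁ ∘ F.neighbours , map inj₂ ∘ F′.neighbours ]′

  arc : ∀ u {v} → v ∈ nbrs u →
    Pointwise F._⟶_ F′._⟶_ u v ⊎ Pointwise F._⟶_ F′._⟶_ v u
  arc (inj₁ u) v∈ with ∈-map⁻ inj₁ v∈
  ... | w , w∈ , refl = Sum.map inj₁ inj₁ (F.∈⇒⟶ u w∈)
  arc (inj₂ u) v∈ with ∈-map⁻ inj₂ v∈
  ... | w , w∈ , refl = Sum.map inj₂ inj₂ (F′.∈⇒⟶ u w∈)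

length-neighbours-inj₁ : ∀ F F′ x → length (neighbours (F ⊎ᶠ F′) (inj₁ x)) ≡ length (neighbours F x)
length-neighbours-inj₁ F F′ x = length-map inj₁ (neighbours F x)

length-neighbours-inj₂ : ∀ F F′ x → length (neighbours (F ⊎ᶠ F′) (inj₂ x)) ≡ length (neighbours F′ x)
length-neighbours-inj₂ F F′ x = length-map inj₂ (neighbours F′ x)

-- Neighbours and two-colouring along a path.

before : ∀ {n} → Fin n → Maybe (Fin n)
before zero    = nothing
before (suc i) = just (inject₁ i)

after : ∀ {n} → Fin n → Maybe (Fin n)
after {suc zero}    zero    = nothing
after {suc (suc n)} zero    = just (suc zero)
after {suc n}       (suc i) = Maybe.map suc (after i)

after-inject₁ : ∀ {n} (i : Fin n) → after (inject₁ i) ≡ just (suc i)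
after-inject₁ {suc n} zero    = refl
after-inject₁ {suc n} (suc i) = cong (Maybe.map suc) (after-inject₁ i)

after-fromℕ : ∀ n → after (fromℕ n) ≡ nothing
after-fromℕ zero    = refl
after-fromℕ (suc n) = cong (Maybe.map suc) (after-fromℕ n)

-- The two values differ by 2. This is the only case in which distinctness of neighbour lists is not
-- a clash of constructors.
before≢after : ∀ {n} (i : Fin n) {j k} → before i ≡ just j → after i ≡ just k → j ≢ k
before≢after {suc n} (suc i) refl q refl with view i
... | ‵fromℕ with () ← trans (sym q) (cong (Maybe.map suc) (after-fromℕ _))
... | ‵inject₁ i′ = ℕ.m≢1+m+n (toℕ i′) (trans (sym (trans (Fin.toℕ-inject₁ _) (Fin.toℕ-inject₁ i′)))
  (trans (cong toℕ (just-injective (trans (sym q) (cong (Maybe.map suc) (after-inject₁ i′)))))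
    (cong suc (ℕ.+-comm 1 (toℕ i′)))))

colour : ∀ {n} → Fin n → Bool
colour zero    = true
colour (suc i) = not (colour i)

colour-inject₁ : ∀ {n} (i : Fin n) → colour (inject₁ i) ≡ colour i
colour-inject₁ zero    = refl
colour-inject₁ (suc i) = cong not (colour-inject₁ i)

-- The cycle with 2 * (2 + ℓ) nodes: two antipodal nodes joined by two
-- paths of 1 + ℓ nodes.

data Cyclic (ℓ : ℕ) : Set where
  bottom top : Cyclic ℓ
  left right : Fin (suc ℓ) → Cyclic ℓ

module _ {ℓ : ℕ} where

  -- The orientation runs up the left path and down the right one. Both are numbered from `bottom`,
  -- so that exchanging `left i` and `right i` is the reflection behind the spectral argument.
  succ : Cyclic ℓ → Cyclic ℓ
  succ bottom    = left zero
  succ (left i)  = maybe′ left top (after i)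
  succ top       = right (fromℕ ℓ)
  succ (right i) = maybe′ right bottom (before i)

  cyclicNeighbours : Cyclic ℓ → List (Cyclic ℓ)
  cyclicNeighbours bottom    = left zero ∷ right zero ∷ []
  cyclicNeighbours top       = left (fromℕ ℓ) ∷ right (fromℕ ℓ) ∷ []
  cyclicNeighbours (left i)  = maybe′ left bottom (before i) ∷ maybe′ left top (after i) ∷ []
  cyclicNeighbours (right i) = maybe′ right bottom (before i) ∷ maybe′ right top (after i) ∷ []

  cyclicSide : Cyclic ℓ → Bool
  cyclicSide bottom    = false
  cyclicSide top       = not (colour (fromℕ ℓ))
  cyclicSide (left i)  = colour i
  cyclicSide (right i) = colour i

  cyclicDistinct : ∀ u → Unique (cyclicNeighbours u)
  cyclicDistinct bottom    = ((λ ()) ∷ []) ∷ [] ∷ []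
  cyclicDistinct top       = ((λ ()) ∷ []) ∷ [] ∷ []
  cyclicDistinct (left i) with before i in p | after i in q
  ... | nothing | nothing = ((λ ()) ∷ []) ∷ [] ∷ []
  ... | nothing | just _  = ((λ ()) ∷ []) ∷ [] ∷ []
  ... | just _  | nothing = ((λ ()) ∷ []) ∷ [] ∷ []
  ... | just _  | just _  = ((λ { refl → before≢after i p q refl }) ∷ []) ∷ [] ∷ []
  cyclicDistinct (right i) with before i in p | after i in q
  ... | nothing | nothing = ((λ ()) ∷ []) ∷ [] ∷ []
  ... | nothing | just _  = ((λ ()) ∷ []) ∷ [] ∷ []
  ... | just _  | nothing = ((λ ()) ∷ []) ∷ [] ∷ []
  ... | just _  | just _  = ((λ { refl → before≢after i p q refl }) ∷ []) ∷ [] ∷ []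

  succ-left-inject₁ : ∀ k → succ (left (inject₁ k)) ≡ left (suc k)
  succ-left-inject₁ k = cong (maybe′ left top) (after-inject₁ k)

  succ-left-fromℕ : succ (left (fromℕ ℓ)) ≡ top
  succ-left-fromℕ = cong (maybe′ left top) (after-fromℕ ℓ)

  ∈-succ : ∀ u → u ∈ cyclicNeighbours (succ u)
  ∈-succ bottom = here refl
  ∈-succ (left i) with view i
  ... | ‵fromℕ     = subst (λ v → left (fromℕ ℓ) ∈ cyclicNeighbours v)
                       (sym succ-left-fromℕ) (here refl)
  ... | ‵inject₁ k = subst (λ v → left (inject₁ k) ∈ cyclicNeighbours v)
                       (sym (succ-left-inject₁ k)) (here refl)
  ∈-succ top             = there (here (sym (cong (maybe′ right top) (after-fromℕ ℓ))))
  ∈-succ (right zero)    = there (here refl)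
  ∈-succ (right (suc k)) = there (here (sym (cong (maybe′ right top) (after-inject₁ k))))

  succ-∈ : ∀ u → succ u ∈ cyclicNeighbours u
  succ-∈ bottom    = here refl
  succ-∈ (left _)  = there (here refl)
  succ-∈ top       = there (here refl)
  succ-∈ (right _) = here refl

  ∈⇒succ : ∀ u {v} → v ∈ cyclicNeighbours u → succ u ≡ v ⊎ succ v ≡ u
  ∈⇒succ bottom          (here refl)         = inj₁ refl
  ∈⇒succ bottom          (there (here refl)) = inj₂ refl
  ∈⇒succ top             (here refl)         = inj₂ succ-left-fromℕ
  ∈⇒succ top             (there (here refl)) = inj₁ refl
  ∈⇒succ (left zero)     (here refl)         = inj₂ refl
  ∈⇒succ (left (suc k))  (here refl)         = inj₂ (succ-left-inject₁ k)
  ∈⇒succ (left i)        (there (here refl)) = inj₁ refl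
  ∈⇒succ (right i)       (here refl)         = inj₁ refl
  ∈⇒succ (right i)       (there (here refl)) = inj₂ (upper i)
    where
    upper : ∀ i → succ (maybe′ right top (after i)) ≡ right i
    upper i with view i
    ... | ‵fromℕ     = cong (succ ∘ maybe′ right top) (after-fromℕ ℓ)
    ... | ‵inject₁ k = cong (succ ∘ maybe′ right top) (after-inject₁ k)

  succ-alternates : ∀ u → cyclicSide (succ u) ≡ not (cyclicSide u)
  succ-alternates bottom = refl
  succ-alternates (left i) with view i
  ... | ‵fromℕ     = cong cyclicSide succ-left-fromℕ
  ... | ‵inject₁ k = trans (cong cyclicSide (succ-left-inject₁ k))
                       (cong not (sym (colour-inject₁ k)))
  succ-alternates top             = sym (not-involutive _)
  succ-alternates (right zero)    = refl
  succ-alternates (right (suc k)) = trans (colour-inject₁ k) (sym (not-involutive _))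

  succ-induction : (P : Cyclic ℓ → Set) → P bottom → (∀ {u} → P u → P (succ u)) → ∀ u → P u
  succ-induction P P-bottom step = λ where
      bottom    → P-bottom
      (left i)  → P-left i
      top       → P-top
      (right i) → >-weakInduction (P ∘ right) (step P-top) (λ _ → step) i
    where
    P-left : ∀ i → P (left i)
    P-left = <-weakInduction (P ∘ left) (step P-bottom)
      (λ k → subst P (succ-left-inject₁ k) ∘ step)

    P-top : P top
    P-top = subst P succ-left-fromℕ (step (P-left (fromℕ ℓ)))

-- Positions along the cycle.

circumference : ℕ → ℕ
circumference ℓ = (2 ℕ.+ ℓ) ℕ.+ (2 ℕ.+ ℓ)

module _ {ℓ : ℕ} where

  position : Cyclic ℓ → ℕ
  position bottom    = 0
  position (left i)  = suc (toℕ i)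
  position top       = 2 ℕ.+ ℓ
  position (right i) = (2 ℕ.+ ℓ) ℕ.+ (suc ℓ ℕ.∸ toℕ i)

  position< : ∀ u → position u < circumference ℓ
  position< bottom    = s≤s z≤n
  position< (left i)  = ℕ.≤-trans (s≤s (Fin.toℕ<n i)) (ℕ.m≤m+n (2 ℕ.+ ℓ) _)
  position< top       = ℕ.m<m+n (2 ℕ.+ ℓ) (s≤s z≤n)
  position< (right i) = ℕ.+-monoʳ-< (2 ℕ.+ ℓ) (s≤s (ℕ.m∸n≤m (suc ℓ) (toℕ i)))

  position-succ : ∀ u → position (succ u) ≡ suc (position u) ⊎
    (succ u ≡ bottom × suc (position u) ≡ circumference ℓ)
  position-succ bottom = inj₁ refl
  position-succ (left i) with view i
  ... | ‵fromℕ     = inj₁ (trans (cong position succ-left-fromℕ)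
                       (cong (2 ℕ.+_) (sym (Fin.toℕ-fromℕ ℓ))))
  ... | ‵inject₁ k = inj₁ (trans (cong position (succ-left-inject₁ k))
                       (cong (2 ℕ.+_) (sym (Fin.toℕ-inject₁ k))))
  position-succ top = inj₁ (trans
    (cong ((2 ℕ.+ ℓ) ℕ.+_) (trans (cong (suc ℓ ℕ.∸_) (Fin.toℕ-fromℕ ℓ)) (ℕ.m+n∸n≡m 1 ℓ)))
    (ℕ.+-comm (2 ℕ.+ ℓ) 1))
  position-succ (right zero)    = inj₂ (refl , sym (ℕ.+-suc (2 ℕ.+ ℓ) (suc ℓ)))
  position-succ (right (suc k)) = inj₁ (trans
    (cong ((2 ℕ.+ ℓ) ℕ.+_) (trans (cong (suc ℓ ℕ.∸_) (Fin.toℕ-inject₁ k))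
      (ℕ.+-∸-assoc 1 (ℕ.<⇒≤ (Fin.toℕ<n k)))))
    (ℕ.+-suc (2 ℕ.+ ℓ) _))

  at : ℕ → Cyclic ℓ
  at = fold bottom succ

  at-position : ∀ u → at (position u) ≡ u
  at-position = succ-induction _ refl λ {u} at-pos → case position-succ u of λ where
    (inj₁ eq)        → trans (cong at eq) (cong succ at-pos)
    (inj₂ (eq , _)) → trans (cong (at ∘ position) eq) (sym eq)

  position-at : ∀ k → k < circumference ℓ → position (at k) ≡ k
  position-at zero    _     = refl
  position-at (suc k) 1+k<L with position-succ (at k)
  ... | inj₁ eq       = trans eq (cong suc (position-at k (ℕ.<⇒≤ 1+k<L)))
  ... | inj₂ (_ , eq) = ⊥-elim (ℕ.<-irrefl
    (trans (cong suc (sym (position-at k (ℕ.<⇒≤ 1+k<L)))) eq) 1+k<L)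

  -- Without a wrap the last step would reach position `circumference ℓ`, beyond the bound on
  -- positions.
  at-circumference : at (circumference ℓ) ≡ bottom
  at-circumference with position-succ (at (ℕ.pred (circumference ℓ)))
  ... | inj₂ (eq , _) = eq
  ... | inj₁ eq = ⊥-elim (ℕ.<-irrefl
    (trans eq (cong suc (position-at _ ℕ.≤-refl))) (position< (at (circumference ℓ))))

  at-next : ∀ k → at (toℕ (next {circumference ℓ} k)) ≡ succ (at (toℕ k))
  at-next k with next-cases k
  ... | inj₁ eq         = cong at eq
  ... | inj₂ (eq , eq₀) = trans (cong at eq₀) (sym (trans (cong at eq) at-circumference))

cyclicGraph : ℕ → Pseudoforest
cyclicGraph ℓ = record
  { Node        = Cyclic ℓ
  ; _⟶_         = λ u v → succ u ≡ v
  ; functional  = λ p q → trans (sym p) q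
  ; neighbours  = cyclicNeighbours
  ; distinct    = cyclicDistinct
  ; ⟶⇒∈         = λ { {u} refl → succ-∈ u }
  ; ⟵⇒∈         = λ { {u} refl → ∈-succ u }
  ; ∈⇒⟶         = ∈⇒succ
  ; side        = cyclicSide
  ; alternating = λ { {u} refl → succ-alternates u }
  }

-- The tree D̃ with spine of 1 + ℓ nodes, two extra leaves being attached
-- to each end of the spine, together with a path of 1 + ℓ nodes.

data Forest (ℓ : ℕ) : Set where
  leaf₁ leaf₂ leaf₃ leaf₄ : Forest ℓ
  spine path : Fin (suc ℓ) → Forest ℓ

module _ {ℓ : ℕ} where

  parent : Forest ℓ → Maybe (Forest ℓ)
  parent leaf₁     = just (spine zero)
  parent leaf₂     = just (spine zero)
  parent leaf₃     = just (spine (fromℕ ℓ))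
  parent leaf₄     = just (spine (fromℕ ℓ))
  parent (spine i) = Maybe.map spine (before i)
  parent (path i)  = Maybe.map path (before i)

  -- Past an end of the spine lie the twin leaves, past an end of the path lies nothing. A spine of
  -- one node thus carries all four leaves.
  spineBelow spineAbove pathBelow pathAbove : Fin (suc ℓ) → List (Forest ℓ)
  spineBelow = maybe′ ([_] ∘ spine) (leaf₁ ∷ leaf₂ ∷ []) ∘ before
  spineAbove = maybe′ ([_] ∘ spine) (leaf₃ ∷ leaf₄ ∷ []) ∘ after
  pathBelow  = maybe′ ([_] ∘ path) [] ∘ before
  pathAbove  = maybe′ ([_] ∘ path) [] ∘ after

  forestNeighbours : Forest ℓ → List (Forest ℓ)
  forestNeighbours leaf₁     = spine zero ∷ []
  forestNeighbours leaf₂     = spine zero ∷ []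
  forestNeighbours leaf₃     = spine (fromℕ ℓ) ∷ []
  forestNeighbours leaf₄     = spine (fromℕ ℓ) ∷ []
  forestNeighbours (spine i) = spineBelow i ++ spineAbove i
  forestNeighbours (path i)  = pathBelow i ++ pathAbove i

  spineAbove-fromℕ : spineAbove (fromℕ ℓ) ≡ leaf₃ ∷ leaf₄ ∷ []
  spineAbove-fromℕ = cong (maybe′ ([_] ∘ spine) _) (after-fromℕ ℓ)

  spineAbove-inject₁ : ∀ k → spineAbove (inject₁ k) ≡ spine (suc k) ∷ []
  spineAbove-inject₁ k = cong (maybe′ ([_] ∘ spine) _) (after-inject₁ k)

  pathAbove-fromℕ : pathAbove (fromℕ ℓ) ≡ []
  pathAbove-fromℕ = cong (maybe′ ([_] ∘ path) _) (after-fromℕ ℓ)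

  pathAbove-inject₁ : ∀ k → pathAbove (inject₁ k) ≡ path (suc k) ∷ []
  pathAbove-inject₁ k = cong (maybe′ ([_] ∘ path) _) (after-inject₁ k)

  forestSide : Forest ℓ → Bool
  forestSide leaf₁     = false
  forestSide leaf₂     = false
  forestSide leaf₃     = not (colour (fromℕ ℓ))
  forestSide leaf₄     = not (colour (fromℕ ℓ))
  forestSide (spine i) = colour i
  forestSide (path i)  = colour i

  -- Distance to the root `spine zero` or `path zero`; it is the rank that excludes cycles in the
  -- forest.
  depth : Forest ℓ → ℕ
  depth leaf₁     = 1
  depth leaf₂     = 1
  depth leaf₃     = suc ℓ
  depth leaf₄     = suc ℓ
  depth (spine i) = toℕ i
  depth (path i)  = toℕ i

  forestDistinct : ∀ u → Unique (forestNeighbours u)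
  forestDistinct leaf₁ = [] ∷ []
  forestDistinct leaf₂ = [] ∷ []
  forestDistinct leaf₃ = [] ∷ []
  forestDistinct leaf₄ = [] ∷ []
  forestDistinct (spine i) with before i in p | after i in q
  ... | nothing | nothing = ((λ ()) ∷ (λ ()) ∷ (λ ()) ∷ []) ∷
                            ((λ ()) ∷ (λ ()) ∷ []) ∷ ((λ ()) ∷ []) ∷ [] ∷ []
  ... | nothing | just _  = ((λ ()) ∷ (λ ()) ∷ []) ∷ ((λ ()) ∷ []) ∷ [] ∷ []
  ... | just _  | nothing = ((λ ()) ∷ (λ ()) ∷ []) ∷ ((λ ()) ∷ []) ∷ [] ∷ []
  ... | just _  | just _  = ((λ { refl → before≢after i p q refl }) ∷ []) ∷ [] ∷ []
  forestDistinct (path i) with before i in p | after i in q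
  ... | nothing | nothing = []
  ... | nothing | just _  = [] ∷ []
  ... | just _  | nothing = [] ∷ []
  ... | just _  | just _  = ((λ { refl → before≢after i p q refl }) ∷ []) ∷ [] ∷ []

  parent-∈ : ∀ u {v} → parent u ≡ just v → v ∈ forestNeighbours u
  parent-∈ leaf₁           refl = here refl
  parent-∈ leaf₂           refl = here refl
  parent-∈ leaf₃           refl = here refl
  parent-∈ leaf₄           refl = here refl
  parent-∈ (spine (suc k)) refl = here refl
  parent-∈ (path (suc k))  refl = here refl

  ∈-parent : ∀ u {v} → parent u ≡ just v → u ∈ forestNeighbours v
  ∈-parent leaf₁           refl = here refl
  ∈-parent leaf₂           refl = there (here refl)
  ∈-parent leaf₃           refl = ∈-++⁺ʳ (spineBelow (fromℕ ℓ))
    (subst (leaf₃ ∈_) (sym spineAbove-fromℕ) (here refl))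
  ∈-parent leaf₄           refl = ∈-++⁺ʳ (spineBelow (fromℕ ℓ))
    (subst (leaf₄ ∈_) (sym spineAbove-fromℕ) (there (here refl)))
  ∈-parent (spine (suc k)) refl = ∈-++⁺ʳ (spineBelow (inject₁ k))
    (subst (spine (suc k) ∈_) (sym (spineAbove-inject₁ k)) (here refl))
  ∈-parent (path (suc k))  refl = ∈-++⁺ʳ (pathBelow (inject₁ k))
    (subst (path (suc k) ∈_) (sym (pathAbove-inject₁ k)) (here refl))

  ∈spineBelow : ∀ i {v} → v ∈ spineBelow i →
    parent (spine i) ≡ just v ⊎ parent v ≡ just (spine i)
  ∈spineBelow zero    (here refl)         = inj₂ refl
  ∈spineBelow zero    (there (here refl)) = inj₂ refl
  ∈spineBelow (suc k) (here refl)         = inj₁ refl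

  ∈spineAbove : ∀ i {v} → v ∈ spineAbove i → parent v ≡ just (spine i)
  ∈spineAbove i v∈ with view i
  ... | ‵inject₁ k with here refl ← subst (_ ∈_) (spineAbove-inject₁ k) v∈ = refl
  ... | ‵fromℕ with subst (_ ∈_) spineAbove-fromℕ v∈
  ...   | here refl         = refl
  ...   | there (here refl) = refl

  ∈pathBelow : ∀ i {v} → v ∈ pathBelow i → parent (path i) ≡ just v
  ∈pathBelow (suc k) (here refl) = refl

  ∈pathAbove : ∀ i {v} → v ∈ pathAbove i → parent v ≡ just (path i)
  ∈pathAbove i v∈ with view i
  ... | ‵inject₁ k with here refl ← subst (_ ∈_) (pathAbove-inject₁ k) v∈ = refl
  ... | ‵fromℕ with () ← subst (_ ∈_) pathAbove-fromℕ v∈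

  ∈⇒parent : ∀ u {v} → v ∈ forestNeighbours u → parent u ≡ just v ⊎ parent v ≡ just u
  ∈⇒parent leaf₁ (here refl) = inj₁ refl
  ∈⇒parent leaf₂ (here refl) = inj₁ refl
  ∈⇒parent leaf₃ (here refl) = inj₁ refl
  ∈⇒parent leaf₄ (here refl) = inj₁ refl
  ∈⇒parent (spine i) = [ ∈spineBelow i , inj₂ ∘ ∈spineAbove i ]′ ∘ ∈-++⁻ (spineBelow i)
  ∈⇒parent (path i)  = Sum.map (∈pathBelow i) (∈pathAbove i) ∘ ∈-++⁻ (pathBelow i)

  parent-alternates : ∀ u {v} → parent u ≡ just v → forestSide v ≡ not (forestSide u)
  parent-alternates leaf₁           refl = refl
  parent-alternates leaf₂           refl = refl
  parent-alternates leaf₃           refl = sym (not-involutive _)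
  parent-alternates leaf₄           refl = sym (not-involutive _)
  parent-alternates (spine (suc k)) refl = trans (colour-inject₁ k) (sym (not-involutive _))
  parent-alternates (path (suc k))  refl = trans (colour-inject₁ k) (sym (not-involutive _))

  depth-parent : ∀ u {v} → parent u ≡ just v → depth v < depth u
  depth-parent leaf₁           refl = s≤s z≤n
  depth-parent leaf₂           refl = s≤s z≤n
  depth-parent leaf₃           refl = s≤s (ℕ.≤-reflexive (Fin.toℕ-fromℕ ℓ))
  depth-parent leaf₄           refl = s≤s (ℕ.≤-reflexive (Fin.toℕ-fromℕ ℓ))
  depth-parent (spine (suc k)) refl = s≤s (ℕ.≤-reflexive (Fin.toℕ-inject₁ k))
  depth-parent (path (suc k))  refl = s≤s (ℕ.≤-reflexive (Fin.toℕ-inject₁ k))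

forest : ℕ → Pseudoforest
forest ℓ = record
  { Node        = Forest ℓ
  ; _⟶_         = λ u v → parent u ≡ just v
  ; functional  = λ p q → just-injective (trans (sym p) q)
  ; neighbours  = forestNeighbours
  ; distinct    = forestDistinct
  ; ⟶⇒∈         = λ {u} → parent-∈ u
  ; ⟵⇒∈         = λ {u} → ∈-parent u
  ; ∈⇒⟶         = ∈⇒parent
  ; side        = forestSide
  ; alternating = λ {u} → parent-alternates u
  }

-- Similarity of adjacency matrices

module LinearAlgebra {c ℓ : Level} (R : CommutativeRing c ℓ) where
  open CommutativeRing R hiding (zero) renaming (refl to ≈-refl; sym to ≈-sym; trans to ≈-trans)
  open Eigen R using (_*ᵥ_; linearCombination)
    renaming (SquareMatrix to Matrix; HasMultiplicity to Multiplicity; module HasMultiplicity to Multiplicity)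
  open import Algebra.Properties.Monoid.Sum +-monoid using (sum-syntax)
  open import Algebra.Properties.CommutativeSemigroup +-commutativeSemigroup
    using () renaming (interchange to +-interchange; x∙yz≈y∙xz to +-exchange)
  open import Algebra.Properties.CommutativeSemigroup *-commutativeSemigroup
    using () renaming (x∙yz≈y∙xz to *-exchange)
  open import Relation.Binary.Reasoning.Setoid setoid

  record Linear {X Y : Set} (F : (X → Carrier) → Y → Carrier) : Set (c ⊔ ℓ) where
    field
      F-cong : ∀ {v w} → (∀ x → v x ≈ w x) → ∀ y → F v y ≈ F w y
      F-+    : ∀ v w y → F (λ x → v x + w x) y ≈ F v y + F w y
      F-*    : ∀ a v y → F (λ x → a * v x) y ≈ a * F v y

    F-0 : ∀ y → F (λ _ → 0#) y ≈ 0#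
    F-0 y = begin
      F (λ _ → 0#) y       ≈⟨ F-cong (λ _ → ≈-sym (zeroˡ 0#)) y ⟩
      F (λ _ → 0# * 0#) y  ≈⟨ F-* 0# (λ _ → 0#) y ⟩
      0# * F (λ _ → 0#) y  ≈⟨ zeroˡ _ ⟩
      0#                   ∎

    F-combination : ∀ {k} (a : Vector Carrier k) (vs : Vector (X → Carrier) k) y →
      F (λ x → ∑[ j < k ] (a j * vs j x)) y ≈ ∑[ j < k ] (a j * F (vs j) y)
    F-combination {zero}  a vs y = F-0 y
    F-combination {suc k} a vs y = ≈-trans (F-+ _ _ y)
      (+-cong (F-* (a zero) (vs zero) y) (F-combination (a ∘ suc) (vs ∘ suc) y))

  open Linear

  module _ {n m} {A : Matrix n} {B : Matrix m}
    {F : Vector Carrier n → Vector Carrier m} {F⁻ : Vector Carrier m → Vector Carrier n}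
    (F-linear : Linear F) (F⁻-linear : Linear F⁻)
    (F-intertwines : ∀ v i → F (A *ᵥ v) i ≈ (B *ᵥ F v) i)
    (F⁻-intertwines : ∀ v i → F⁻ (B *ᵥ v) i ≈ (A *ᵥ F⁻ v) i)
    (F⁻F : ∀ v i → F⁻ (F v) i ≈ v i) (FF⁻ : ∀ v i → F (F⁻ v) i ≈ v i)
    where

    -- The image of an eigenbasis is one again: eigenvectors are preserved by intertwining, while
    -- independence and spanning are obtained by pulling back along `F⁻`. No dimension count enters,
    -- so the argument works over any commutative ring.
    similar⇒multiplicity : ∀ {μ k} → Multiplicity A μ k → Multiplicity B μ k
    similar⇒multiplicity {μ} {k} M = record
      { basis       = λ j → F (basis j)
      ; eigen       = λ j i → begin
          (B *ᵥ F (basis j)) i         ≈⟨ F-intertwines (basis j) i ⟨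
          F (A *ᵥ basis j) i           ≈⟨ F-cong F-linear (eigen j) i ⟩
          F (λ i → μ * basis j i) i    ≈⟨ F-* F-linear μ (basis j) i ⟩
          μ * F (basis j) i            ∎
      ; independent = λ a zero-combination → independent a λ i → begin
          linearCombination a basis i                    ≈⟨ F⁻F _ i ⟨
          F⁻ (F (linearCombination a basis)) i
            ≈⟨ F-cong F⁻-linear (F-combination F-linear a basis) i ⟩
          F⁻ (linearCombination a (λ j → F (basis j))) i
            ≈⟨ F-cong F⁻-linear zero-combination i ⟩
          F⁻ (λ _ → 0#) i                                ≈⟨ F-0 F⁻-linear i ⟩
          0#                                             ∎
      ; spanning    = λ v v-eigen →
          let a , v≈ = spanning (F⁻ v) λ i → begin
                (A *ᵥ F⁻ v) i          ≈⟨ F⁻-intertwines v i ⟨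
                F⁻ (B *ᵥ v) i          ≈⟨ F-cong F⁻-linear v-eigen i ⟩
                F⁻ (λ i → μ * v i) i   ≈⟨ F-* F⁻-linear μ v i ⟩
                μ * F⁻ v i             ∎
          in a , λ i → begin
            v i                                      ≈⟨ FF⁻ v i ⟨
            F (F⁻ v) i                               ≈⟨ F-cong F-linear v≈ i ⟩
            F (linearCombination a basis) i          ≈⟨ F-combination F-linear a basis i ⟩
            linearCombination a (λ j → F (basis j)) i ∎
      }
      where open Multiplicity M

  listSum : {X : Set} → List X → (X → Carrier) → Carrier
  listSum []       v = 0#
  listSum (x ∷ xs) v = v x + listSum xs v

  listSum-cong : {X : Set} (xs : List X) {v w : X → Carrier} → (∀ x → v x ≈ w x) →
    listSum xs v ≈ listSum xs w
  listSum-cong []       eq = ≈-refl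
  listSum-cong (x ∷ xs) eq = +-cong (eq x) (listSum-cong xs eq)

  listSum-map : {X Y : Set} (f : X → Y) (xs : List X) (v : Y → Carrier) →
    listSum (map f xs) v ≡ listSum xs (v ∘ f)
  listSum-map f []       v = refl
  listSum-map f (x ∷ xs) v = cong (v (f x) +_) (listSum-map f xs v)

  listSum-↭ : {X : Set} {xs ys : List X} (v : X → Carrier) → xs ↭ ys →
    listSum xs v ≈ listSum ys v
  listSum-↭ v Perm.refl         = ≈-refl
  listSum-↭ v (prep x p)        = +-congˡ (listSum-↭ v p)
  listSum-↭ v (swap x y p)      = ≈-trans (+-congˡ (+-congˡ (listSum-↭ v p))) (+-exchange _ _ _)
  listSum-↭ v (Perm.trans p q)  = ≈-trans (listSum-↭ v p) (listSum-↭ v q)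

  -- A general `f` is what the induction needs, as it passes to `f ∘ suc`. The instance `f = id`
  -- turns a row of the adjacency matrix into a sum over filtered vertices.
  indicator-sum : ∀ {n} {X : Set} {P : Pred X 0ℓ} (P? : Decidable P)
    (f : Fin n → X) (v : X → Carrier) →
    ∑[ j < n ] ((if does (P? (f j)) then 1# else 0#) * v (f j)) ≈
    listSum (filter P? (tabulate f)) v
  indicator-sum {zero}  P? f v = ≈-refl
  indicator-sum {suc n} P? f v with does (P? (f zero))
  ... | true  = +-cong (*-identityˡ _) (indicator-sum P? (f ∘ suc) v)
  ... | false = ≈-trans (+-cong (zeroˡ _) (indicator-sum P? (f ∘ suc) v)) (+-identityˡ _)

  module _ {K : Set} (⟦_⟧ : K → Carrier) {X : Set} where

    -- A sparse matrix row applied to a vector. Coefficients come from a separate type `K`,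
    -- instantiated by ℚ inside ℝ, so that the same rows can also be evaluated over ℚ.
    rowSum : List (K × X) → (X → Carrier) → Carrier
    rowSum []             v = 0#
    rowSum ((q , x) ∷ qs) v = ⟦ q ⟧ * v x + rowSum qs v

    rowSum-cong : ∀ qs {v w} → (∀ x → v x ≈ w x) → rowSum qs v ≈ rowSum qs w
    rowSum-cong []             eq = ≈-refl
    rowSum-cong ((q , x) ∷ qs) eq = +-cong (*-congˡ (eq x)) (rowSum-cong qs eq)

    rowSum-+ : ∀ qs v w → rowSum qs (λ x → v x + w x) ≈ rowSum qs v + rowSum qs w
    rowSum-+ []             v w = ≈-sym (+-identityˡ 0#)
    rowSum-+ ((q , x) ∷ qs) v w =
      ≈-trans (+-cong (distribˡ _ _ _) (rowSum-+ qs v w)) (+-interchange _ _ _ _)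

    rowSum-* : ∀ qs a v → rowSum qs (λ x → a * v x) ≈ a * rowSum qs v
    rowSum-* []             a v = ≈-sym (zeroʳ a)
    rowSum-* ((q , x) ∷ qs) a v =
      ≈-trans (+-cong (*-exchange _ _ _) (rowSum-* qs a v)) (≈-sym (distribˡ _ _ _))

    rowSum-linear : {Y Z W : Set} (rows : Y → List (K × X)) (f : X → Z) (g : W → Y) →
      Linear (λ v i → rowSum (rows (g i)) (v ∘ f))
    rowSum-linear rows f g = record
      { F-cong = λ eq i → rowSum-cong (rows (g i)) (eq ∘ f)
      ; F-+    = λ v w i → rowSum-+ (rows (g i)) (v ∘ f) (w ∘ f)
      ; F-*    = λ a v i → rowSum-* (rows (g i)) a (v ∘ f)
      }

  module _ (F : Pseudoforest) {N : ℕ} (enum : Fin N ↔ Node F) where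
    open Realise F enum
    open Graph G using (_~?_)

    -- Over ℝ this unfolds to `Graph.adjacencyMatrix G`, so statements about it apply directly to
    -- `Cospectral`.
    adjacency : Matrix N
    adjacency i j = if does (i ~? j) then 1# else 0#

    adjacency-product : ∀ v i → (adjacency *ᵥ v) i ≈ listSum (neighbours F (name i)) (v ∘ index)
    adjacency-product v i = begin
      (adjacency *ᵥ v) i                             ≈⟨ indicator-sum (i ~?_) id v ⟩
      listSum (filter (i ~?_) (allFin N)) v          ≈⟨ listSum-↭ v (filter-neighbours i) ⟩
      listSum (map index (neighbours F (name i))) v  ≡⟨ listSum-map index (neighbours F (name i)) v ⟩
      listSum (neighbours F (name i)) (v ∘ index)    ∎

  module _ {K : Set} (⟦_⟧ : K → Carrier) (F F′ : Pseudoforest) {N N′ : ℕ}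
    (enum : Fin N ↔ Node F) (enum′ : Fin N′ ↔ Node F′)
    (rows : Node F′ → List (K × Node F))
    where
    private
      module E  = Realise F enum
      module E′ = Realise F′ enum′

    transport : Vector Carrier N → Vector Carrier N′
    transport v i = rowSum ⟦_⟧ (rows (E′.name i)) (v ∘ E.index)

    transport-linear : Linear transport
    transport-linear = rowSum-linear ⟦_⟧ rows E.index E′.name

    transport-intertwines :
      (∀ v y → rowSum ⟦_⟧ (rows y) (λ x → listSum (neighbours F x) v) ≈
               listSum (neighbours F′ y) (λ x → rowSum ⟦_⟧ (rows x) v)) →
      ∀ v i → transport (adjacency F enum *ᵥ v) i ≈ (adjacency F′ enum′ *ᵥ transport v) i
    transport-intertwines intertwines v i = begin
      rowSum ⟦_⟧ qs (λ x → (adjacency F enum *ᵥ v) (E.index x))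
        ≈⟨ rowSum-cong ⟦_⟧ qs (λ x → ≈-trans (adjacency-product F enum v (E.index x))
             (reflexive (cong (λ z → listSum (neighbours F z) (v ∘ E.index)) (E.strictlyInverseˡ x)))) ⟩
      rowSum ⟦_⟧ qs (λ x → listSum (neighbours F x) (v ∘ E.index))
        ≈⟨ intertwines (v ∘ E.index) (E′.name i) ⟩
      listSum ns (λ y → rowSum ⟦_⟧ (rows y) (v ∘ E.index))
        ≈⟨ listSum-cong ns (λ y → reflexive (cong (λ z → rowSum ⟦_⟧ (rows z) (v ∘ E.index))
             (E′.strictlyInverseˡ y))) ⟨
      listSum ns (transport v ∘ E′.index)
        ≈⟨ adjacency-product F′ enum′ (transport v) i ⟨
      (adjacency F′ enum′ *ᵥ transport v) i ∎
      where
      qs = rows (E′.name i)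
      ns = neighbours F′ (E′.name i)

  transport-inverse : {K : Set} (⟦_⟧ : K → Carrier) (F F′ : Pseudoforest) {N N′ : ℕ}
    (enum : Fin N ↔ Node F) (enum′ : Fin N′ ↔ Node F′)
    (rows : Node F′ → List (K × Node F)) (rows⁻ : Node F → List (K × Node F′)) →
    (∀ v x → rowSum ⟦_⟧ (rows⁻ x) (λ y → rowSum ⟦_⟧ (rows y) v) ≈ v x) →
    ∀ v i → transport ⟦_⟧ F′ F enum′ enum rows⁻ (transport ⟦_⟧ F F′ enum enum′ rows v) i ≈ v i
  transport-inverse ⟦_⟧ F F′ enum enum′ rows rows⁻ inverse v i = begin
    rowSum ⟦_⟧ qs (λ y → rowSum ⟦_⟧ (rows (E′.name (E′.index y))) (v ∘ E.index))
      ≈⟨ rowSum-cong ⟦_⟧ qs (λ y → reflexive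
           (cong (λ z → rowSum ⟦_⟧ (rows z) (v ∘ E.index)) (E′.strictlyInverseˡ y))) ⟩
    rowSum ⟦_⟧ qs (λ y → rowSum ⟦_⟧ (rows y) (v ∘ E.index))
      ≈⟨ inverse (v ∘ E.index) (E.name i) ⟩
    v (E.index (E.name i))
      ≡⟨ cong v (E.strictlyInverseʳ i) ⟩
    v i ∎
    where
    module E  = Realise F enum
    module E′ = Realise F′ enum′
    qs = rows⁻ (E.name i)

  module _ {K : Set} (⟦_⟧ : K → Carrier) (F F′ : Pseudoforest) {N N′ : ℕ}
    (enum : Fin N ↔ Node F) (enum′ : Fin N′ ↔ Node F′)
    (rows : Node F′ → List (K × Node F)) (rows⁻ : Node F → List (K × Node F′))
    (intertwines : ∀ v y →
      rowSum ⟦_⟧ (rows y) (λ x → listSum (neighbours F x) v) ≈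
      listSum (neighbours F′ y) (λ x → rowSum ⟦_⟧ (rows x) v))
    (intertwines⁻ : ∀ v x →
      rowSum ⟦_⟧ (rows⁻ x) (λ y → listSum (neighbours F′ y) v) ≈
      listSum (neighbours F x) (λ y → rowSum ⟦_⟧ (rows⁻ y) v))
    (inverseˡ : ∀ v x → rowSum ⟦_⟧ (rows⁻ x) (λ y → rowSum ⟦_⟧ (rows y) v) ≈ v x)
    (inverseʳ : ∀ v y → rowSum ⟦_⟧ (rows y) (λ x → rowSum ⟦_⟧ (rows⁻ x) v) ≈ v y)
    where

    transport-multiplicity : ∀ μ k →
      Multiplicity (adjacency F enum) μ k → Multiplicity (adjacency F′ enum′) μ k
    transport-multiplicity μ k = similar⇒multiplicity
      (transport-linear ⟦_⟧ F F′ enum enum′ rows) (transport-linear ⟦_⟧ F′ F enum′ enum rows⁻)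
      (transport-intertwines ⟦_⟧ F F′ enum enum′ rows intertwines)
      (transport-intertwines ⟦_⟧ F′ F enum′ enum rows⁻ intertwines⁻)
      (transport-inverse ⟦_⟧ F F′ enum enum′ rows rows⁻ inverseˡ)
      (transport-inverse ⟦_⟧ F′ F enum′ enum rows⁻ rows inverseʳ)

-- Intertwining matrices with rational entries.

total : {X : Set} → List X → (X → ℚ) → ℚ
total []       w = 0ℚ
total (x ∷ xs) w = w x ℚ.+ total xs w

combine : {X : Set} → List (ℚ × X) → (X → ℚ) → ℚ
combine []             w = 0ℚ
combine ((q , x) ∷ qs) w = q ℚ.* w x ℚ.+ combine qs w

total-cong : {X : Set} (xs : List X) {w w′ : X → ℚ} → (∀ x → w x ≡ w′ x) →
  total xs w ≡ total xs w′
total-cong []       eq = refl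
total-cong (x ∷ xs) eq = cong₂ ℚ._+_ (eq x) (total-cong xs eq)

combine-cong : {X : Set} (qs : List (ℚ × X)) {w w′ : X → ℚ} → (∀ x → w x ≡ w′ x) →
  combine qs w ≡ combine qs w′
combine-cong []             eq = refl
combine-cong ((q , x) ∷ qs) eq = cong₂ ℚ._+_ (cong (q ℚ.*_) (eq x)) (combine-cong qs eq)

-- A rational matrix S with S A = A′ S for the adjacency matrices A and A′, given by its sparse rows
-- and tested on vectors `w`.
record _⇝_ (F F′ : Pseudoforest) : Set where
  field
    rows        : Node F′ → List (ℚ × Node F)
    intertwines : ∀ w y → combine (rows y) (λ x → total (neighbours F x) w) ≡
                          total (neighbours F′ y) (λ x → combine (rows x) w)

open _⇝_

⟦_⟧ : ∀ {F F′} → F ⇝ F′ → (Node F → ℚ) → Node F′ → ℚ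
⟦ S ⟧ w y = combine (rows S y) w

-- Addition and multiplication of reals act termwise on the sequences, so
-- an identity between ℚ-linear combinations may be checked termwise in ℚ.

open LinearAlgebra ℝ-commutativeRing using (listSum; rowSum; transport-multiplicity)

≗⇒≃ : ∀ x y → (∀ t → seq x t ≡ seq y t) → x ≃ y
≗⇒≃ x y eq ε 0<ε = 0 , λ t _ → subst (ℚ._< ε)
  (sym (trans (cong (λ q → ℚ.∣ q ℚ.- seq y t ∣) (eq t)) (cong ℚ.∣_∣ (ℚ.+-inverseʳ (seq y t))))) 0<ε

module _ (t : ℕ) where

  seq-listSum : {X : Set} (xs : List X) (v : X → ℝ) {w : X → ℚ} →
    (∀ x → seq (v x) t ≡ w x) → seq (listSum xs v) t ≡ total xs w
  seq-listSum []       v eq = refl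
  seq-listSum (x ∷ xs) v eq = cong₂ ℚ._+_ (eq x) (seq-listSum xs v eq)

  seq-rowSum : {X : Set} (qs : List (ℚ × X)) (v : X → ℝ) {w : X → ℚ} →
    (∀ x → seq (v x) t ≡ w x) → seq (rowSum fromℚ qs v) t ≡ combine qs w
  seq-rowSum []             v eq = refl
  seq-rowSum ((q , x) ∷ qs) v eq = cong₂ ℚ._+_ (cong (q ℚ.*_) (eq x)) (seq-rowSum qs v eq)

intertwines-ℝ : ∀ {F F′} (S : F ⇝ F′) v y →
  rowSum fromℚ (rows S y) (λ x → listSum (neighbours F x) v) ≃
  listSum (neighbours F′ y) (λ x → rowSum fromℚ (rows S x) v)
intertwines-ℝ {F} {F′} S v y = ≗⇒≃
  (rowSum fromℚ (rows S y) (λ x → listSum (neighbours F x) v))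
  (listSum (neighbours F′ y) (λ x → rowSum fromℚ (rows S x) v)) λ t →
  trans (seq-rowSum t (rows S y) _ λ x → seq-listSum t (neighbours F x) v λ _ → refl)
  (trans (intertwines S (λ x → seq (v x) t) y)
  (sym (seq-listSum t (neighbours F′ y) _ λ x → seq-rowSum t (rows S x) v λ _ → refl)))

inverse-ℝ : ∀ {F F′} (S : F ⇝ F′) (T : F′ ⇝ F) → (∀ w x → ⟦ T ⟧ (⟦ S ⟧ w) x ≡ w x) →
  ∀ v x → rowSum fromℚ (rows T x) (λ y → rowSum fromℚ (rows S y) v) ≃ v x
inverse-ℝ S T TS v x = ≗⇒≃
  (rowSum fromℚ (rows T x) (λ y → rowSum fromℚ (rows S y) v)) (v x) λ t →
  trans (seq-rowSum t (rows T x) _ λ y → seq-rowSum t (rows S y) v λ _ → refl)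
    (TS (λ x → seq (v x) t) x)

-- Mutually inverse intertwiners make the adjacency matrices similar; the two directions of the
-- equivalence differ by exchanging `S` and `T`.
cospectral : ∀ {F F′ : Pseudoforest} {N N′} (enum : Fin N ↔ Node F) (enum′ : Fin N′ ↔ Node F′)
  (S : F ⇝ F′) (T : F′ ⇝ F) → (∀ w x → ⟦ T ⟧ (⟦ S ⟧ w) x ≡ w x) → (∀ w y → ⟦ S ⟧ (⟦ T ⟧ w) y ≡ w y) →
  Cospectral (Realise.G F enum) (Realise.G F′ enum′)
cospectral {F} {F′} enum enum′ S T TS ST μ k = mk⇔
  (transport-multiplicity fromℚ F F′ enum enum′ (rows S) (rows T)
    (intertwines-ℝ S) (intertwines-ℝ T) (inverse-ℝ S T TS) (inverse-ℝ T S ST) μ k)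
  (transport-multiplicity fromℚ F′ F enum′ enum (rows T) (rows S)
    (intertwines-ℝ T) (intertwines-ℝ S) (inverse-ℝ T S ST) (inverse-ℝ S T TS) μ k)

total-map : {X Y : Set} (f : X → Y) (xs : List X) (w : Y → ℚ) →
  total (map f xs) w ≡ total xs (w ∘ f)
total-map f []       w = refl
total-map f (x ∷ xs) w = cong (w (f x) ℚ.+_) (total-map f xs w)

combine-map : {X Y : Set} (f : X → Y) (qs : List (ℚ × X)) (w : Y → ℚ) →
  combine (map (map₂ f) qs) w ≡ combine qs (w ∘ f)
combine-map f []             w = refl
combine-map f ((q , x) ∷ qs) w = cong (q ℚ.* w (f x) ℚ.+_) (combine-map f qs w)

combine-single : {X : Set} (x : X) (w : X → ℚ) → combine ((1ℚ , x) ∷ []) w ≡ w x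
combine-single x w = trans (ℚ.+-identityʳ _) (ℚ.*-identityˡ (w x))

module _ (C : Pseudoforest) {F F′ : Pseudoforest} where
  open ≡.≡-Reasoning

  -- The block matrix with blocks identity and S. It allows a common component, here the cycle
  -- fixing the girth, to be added to both graphs.
  beside : F ⇝ F′ → (C ⊎ᶠ F) ⇝ (C ⊎ᶠ F′)
  beside S = record { rows = rs ; intertwines = commutes }
    where
    rs : Node C ⊎ Node F′ → List (ℚ × (Node C ⊎ Node F))
    rs = [ (λ c → (1ℚ , inj₁ c) ∷ []) , map (map₂ inj₂) ∘ rows S ]′

    commutes : ∀ w y → combine (rs y) (λ x → total (neighbours (C ⊎ᶠ F) x) w) ≡
                       total (neighbours (C ⊎ᶠ F′) y) (λ x → combine (rs x) w)
    commutes w (inj₁ c) = begin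
      combine (rs (inj₁ c)) (λ x → total (neighbours (C ⊎ᶠ F) x) w)
        ≡⟨ combine-single (inj₁ c) (λ x → total (neighbours (C ⊎ᶠ F) x) w) ⟩
      total (map inj₁ (neighbours C c)) w
        ≡⟨ total-map inj₁ (neighbours C c) w ⟩
      total (neighbours C c) (w ∘ inj₁)
        ≡⟨ total-cong (neighbours C c) (λ d → combine-single (inj₁ d) w) ⟨
      total (neighbours C c) (λ d → combine (rs (inj₁ d)) w)
        ≡⟨ total-map inj₁ (neighbours C c) (λ x → combine (rs x) w) ⟨
      total (map inj₁ (neighbours C c)) (λ x → combine (rs x) w) ∎
    commutes w (inj₂ y) = begin
      combine (map (map₂ inj₂) (rows S y)) (λ x → total (neighbours (C ⊎ᶠ F) x) w)
        ≡⟨ combine-map inj₂ (rows S y) (λ x → total (neighbours (C ⊎ᶠ F) x) w) ⟩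
      combine (rows S y) (λ x → total (map inj₂ (neighbours F x)) w)
        ≡⟨ combine-cong (rows S y) (λ x → total-map inj₂ (neighbours F x) w) ⟩
      combine (rows S y) (λ x → total (neighbours F x) (w ∘ inj₂))
        ≡⟨ intertwines S (w ∘ inj₂) y ⟩
      total (neighbours F′ y) (λ x → combine (rows S x) (w ∘ inj₂))
        ≡⟨ total-cong (neighbours F′ y) (λ x → combine-map inj₂ (rows S x) w) ⟨
      total (neighbours F′ y) (λ x → combine (rs (inj₂ x)) w)
        ≡⟨ total-map inj₂ (neighbours F′ y) (λ x → combine (rs x) w) ⟨
      total (map inj₂ (neighbours F′ y)) (λ x → combine (rs x) w) ∎

beside-inverse : ∀ {F F′} C (S : F ⇝ F′) (T : F′ ⇝ F) → (∀ w x → ⟦ T ⟧ (⟦ S ⟧ w) x ≡ w x) →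
  ∀ w x → ⟦ beside C T ⟧ (⟦ beside C S ⟧ w) x ≡ w x
beside-inverse C S T TS w (inj₁ c) =
  trans (combine-single (inj₁ c) (⟦ beside C S ⟧ w)) (combine-single (inj₁ c) w)
beside-inverse C S T TS w (inj₂ x) = trans (combine-map inj₂ (rows T x) (⟦ beside C S ⟧ w))
  (trans (combine-cong (rows T x) λ y → combine-map inj₂ (rows S y) w) (TS (w ∘ inj₂) x))

-- Two cospectral families

mean skew plus minus : {A : Set} → A → A → List (ℚ × A)
mean  x y = (½ , x) ∷ (½ , y) ∷ []
skew  x y = (½ , x) ∷ (ℚ.- ½ , y) ∷ []
plus  x y = (1ℚ , x) ∷ (1ℚ , y) ∷ []
minus x y = (1ℚ , x) ∷ (ℚ.- 1ℚ , y) ∷ []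

-- The value on a leaf: the twin-symmetric part `x` comes from the cycle, the half difference of the
-- old twins is kept. An even function is doubled on the spine by `plus` but not on the leaves,
-- since two leaves with one value already contribute twice that value to the end of the spine.
shift : {A : Set} → A → A → A → List (ℚ × A)
shift x y z = (1ℚ , x) ∷ skew y z

-- Functions on the cycle split into even and odd ones under the reflection
-- exchanging left and right; the odd ones behave like functions on a path,
-- the even ones like functions on D̃ that agree on twin leaves.  Exchanging the
-- two descriptions transforms one disjoint union into the other.
module _ {n m : ℕ} where
  switch : Node (cyclicGraph m ⊎ᶠ forest n) → List (ℚ × Node (cyclicGraph n ⊎ᶠ forest m))
  switch (inj₁ bottom)    = mean (inj₂ leaf₁) (inj₂ leaf₂)
  switch (inj₁ top)       = mean (inj₂ leaf₃) (inj₂ leaf₄)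
  switch (inj₁ (left i))  = mean (inj₂ (spine i)) (inj₂ (path i))
  switch (inj₁ (right i)) = skew (inj₂ (spine i)) (inj₂ (path i))
  switch (inj₂ leaf₁)     = shift (inj₁ bottom) (inj₂ leaf₁) (inj₂ leaf₂)
  switch (inj₂ leaf₂)     = shift (inj₁ bottom) (inj₂ leaf₂) (inj₂ leaf₁)
  switch (inj₂ leaf₃)     = shift (inj₁ top) (inj₂ leaf₃) (inj₂ leaf₄)
  switch (inj₂ leaf₄)     = shift (inj₁ top) (inj₂ leaf₄) (inj₂ leaf₃)
  switch (inj₂ (spine i)) = plus (inj₁ (left i)) (inj₁ (right i))
  switch (inj₂ (path i))  = minus (inj₁ (left i)) (inj₁ (right i))

module _ {n m : ℕ} (w : Node (cyclicGraph n ⊎ᶠ forest m) → ℚ) where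
  open ℚSolver.+-*-Solver

  -- `comb` and `tot` mirror `combine` and `total` among solver polynomials, so that each equation
  -- below evaluates to the goal itself.
  comb : ∀ {k} → List (ℚ × Polynomial k) → Polynomial k
  comb = foldr (λ { (q , x) y → con q :* x :+ y }) (con 0ℚ)

  tot : ∀ {k} → List (Polynomial k) → Polynomial k
  tot = foldr _:+_ (con 0ℚ)

  -- The formula is its own inverse once `n` and `m` are exchanged: half sums and half differences
  -- undo sums and differences, and the twin differences, passed on unchanged, recover the leaves
  -- from their mean.
  switch-involutive : ∀ x →
    combine (switch {m} {n} x) (λ y → combine (switch {n} {m} y) w) ≡ w x
  switch-involutive (inj₁ bottom) = solve 3
    (λ a b c → comb (mean (comb (shift a b c)) (comb (shift a c b))) := a)
    refl (w (inj₁ bottom)) (w (inj₂ leaf₁)) (w (inj₂ leaf₂))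
  switch-involutive (inj₁ top) = solve 3
    (λ a b c → comb (mean (comb (shift a b c)) (comb (shift a c b))) := a)
    refl (w (inj₁ top)) (w (inj₂ leaf₃)) (w (inj₂ leaf₄))
  switch-involutive (inj₁ (left i)) = solve 2
    (λ a b → comb (mean (comb (plus a b)) (comb (minus a b))) := a)
    refl (w (inj₁ (left i))) (w (inj₁ (right i)))
  switch-involutive (inj₁ (right i)) = solve 2
    (λ a b → comb (skew (comb (plus a b)) (comb (minus a b))) := b)
    refl (w (inj₁ (left i))) (w (inj₁ (right i)))
  switch-involutive (inj₂ leaf₁) = solve 3
    (λ a b c →
      comb (shift (comb (mean a b)) (comb (shift c a b)) (comb (shift c b a))) :=
      a)
    refl (w (inj₂ leaf₁)) (w (inj₂ leaf₂)) (w (inj₁ bottom))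
  switch-involutive (inj₂ leaf₂) = solve 3
    (λ a b c →
      comb (shift (comb (mean a b)) (comb (shift c b a)) (comb (shift c a b))) :=
      b)
    refl (w (inj₂ leaf₁)) (w (inj₂ leaf₂)) (w (inj₁ bottom))
  switch-involutive (inj₂ leaf₃) = solve 3
    (λ a b c →
      comb (shift (comb (mean a b)) (comb (shift c a b)) (comb (shift c b a))) :=
      a)
    refl (w (inj₂ leaf₃)) (w (inj₂ leaf₄)) (w (inj₁ top))
  switch-involutive (inj₂ leaf₄) = solve 3
    (λ a b c →
      comb (shift (comb (mean a b)) (comb (shift c b a)) (comb (shift c a b))) :=
      b)
    refl (w (inj₂ leaf₃)) (w (inj₂ leaf₄)) (w (inj₁ top))
  switch-involutive (inj₂ (spine i)) = solve 2
    (λ a b → comb (plus (comb (mean a b)) (comb (skew a b))) := a)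
    refl (w (inj₂ (spine i))) (w (inj₂ (path i)))
  switch-involutive (inj₂ (path i)) = solve 2
    (λ a b → comb (minus (comb (mean a b)) (comb (skew a b))) := b)
    refl (w (inj₂ (spine i))) (w (inj₂ (path i)))

  -- Inside the paths all four families obey the same neighbour rule, so only the ends matter. There
  -- an even function sees `bottom` or `top` in the role of two leaves, while an odd one vanishes on
  -- both nodes, as if the path stopped. Both ends coincide when the path has one node, whence the
  -- case `nothing | nothing`.
  switch-intertwines : ∀ y →
    combine (switch y) (λ x → total (neighbours (cyclicGraph n ⊎ᶠ forest m) x) w) ≡
    total (neighbours (cyclicGraph m ⊎ᶠ forest n) y) (λ x → combine (switch x) w)
  switch-intertwines (inj₁ bottom) = solve 2
    (λ a b →
      comb (mean (tot (a ∷ [])) (tot (a ∷ []))) :=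
      tot (comb (mean a b) ∷ comb (skew a b) ∷ []))
    refl (w (inj₂ (spine zero))) (w (inj₂ (path zero)))
  switch-intertwines (inj₁ top) = solve 2
    (λ a b →
      comb (mean (tot (a ∷ [])) (tot (a ∷ []))) :=
      tot (comb (mean a b) ∷ comb (skew a b) ∷ []))
    refl (w (inj₂ (spine (fromℕ _)))) (w (inj₂ (path (fromℕ _))))
  switch-intertwines (inj₂ leaf₁) = solve 3
    (λ a b c →
      comb (shift (tot (a ∷ b ∷ [])) (tot (c ∷ [])) (tot (c ∷ []))) :=
      tot (comb (plus a b) ∷ []))
    refl (w (inj₁ (left zero))) (w (inj₁ (right zero))) (w (inj₂ (spine zero)))
  switch-intertwines (inj₂ leaf₂) = solve 3
    (λ a b c →
      comb (shift (tot (a ∷ b ∷ [])) (tot (c ∷ [])) (tot (c ∷ []))) :=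
      tot (comb (plus a b) ∷ []))
    refl (w (inj₁ (left zero))) (w (inj₁ (right zero))) (w (inj₂ (spine zero)))
  switch-intertwines (inj₂ leaf₃) = solve 3
    (λ a b c →
      comb (shift (tot (a ∷ b ∷ [])) (tot (c ∷ [])) (tot (c ∷ []))) :=
      tot (comb (plus a b) ∷ []))
    refl (w (inj₁ (left (fromℕ _)))) (w (inj₁ (right (fromℕ _)))) (w (inj₂ (spine (fromℕ _))))
  switch-intertwines (inj₂ leaf₄) = solve 3
    (λ a b c →
      comb (shift (tot (a ∷ b ∷ [])) (tot (c ∷ [])) (tot (c ∷ []))) :=
      tot (comb (plus a b) ∷ []))
    refl (w (inj₁ (left (fromℕ _)))) (w (inj₁ (right (fromℕ _)))) (w (inj₂ (spine (fromℕ _))))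
  switch-intertwines (inj₁ (left i)) with before i | after i
  ... | nothing | nothing = solve 4
    (λ a b c d →
      comb (mean (tot (a ∷ b ∷ c ∷ d ∷ [])) (tot ([]))) :=
      tot (comb (mean a b) ∷ comb (mean c d) ∷ []))
    refl (w (inj₂ leaf₁)) (w (inj₂ leaf₂)) (w (inj₂ leaf₃)) (w (inj₂ leaf₄))
  ... | nothing | just k = solve 4
    (λ a b c d →
      comb (mean (tot (a ∷ b ∷ c ∷ [])) (tot (d ∷ []))) :=
      tot (comb (mean a b) ∷ comb (mean c d) ∷ []))
    refl (w (inj₂ leaf₁)) (w (inj₂ leaf₂)) (w (inj₂ (spine k))) (w (inj₂ (path k)))
  ... | just j | nothing = solve 4
    (λ a b c d →
      comb (mean (tot (a ∷ b ∷ c ∷ [])) (tot (d ∷ []))) :=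
      tot (comb (mean a d) ∷ comb (mean b c) ∷ []))
    refl (w (inj₂ (spine j))) (w (inj₂ leaf₃)) (w (inj₂ leaf₄)) (w (inj₂ (path j)))
  ... | just j | just k = solve 4
    (λ a b c d →
      comb (mean (tot (a ∷ b ∷ [])) (tot (c ∷ d ∷ []))) :=
      tot (comb (mean a c) ∷ comb (mean b d) ∷ []))
    refl (w (inj₂ (spine j))) (w (inj₂ (spine k))) (w (inj₂ (path j))) (w (inj₂ (path k)))
  switch-intertwines (inj₁ (right i)) with before i | after i
  ... | nothing | nothing = solve 4
    (λ a b c d →
      comb (skew (tot (a ∷ b ∷ c ∷ d ∷ [])) (tot ([]))) :=
      tot (comb (mean a b) ∷ comb (mean c d) ∷ []))
    refl (w (inj₂ leaf₁)) (w (inj₂ leaf₂)) (w (inj₂ leaf₃)) (w (inj₂ leaf₄))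
  ... | nothing | just k = solve 4
    (λ a b c d →
      comb (skew (tot (a ∷ b ∷ c ∷ [])) (tot (d ∷ []))) :=
      tot (comb (mean a b) ∷ comb (skew c d) ∷ []))
    refl (w (inj₂ leaf₁)) (w (inj₂ leaf₂)) (w (inj₂ (spine k))) (w (inj₂ (path k)))
  ... | just j | nothing = solve 4
    (λ a b c d →
      comb (skew (tot (a ∷ b ∷ c ∷ [])) (tot (d ∷ []))) :=
      tot (comb (skew a d) ∷ comb (mean b c) ∷ []))
    refl (w (inj₂ (spine j))) (w (inj₂ leaf₃)) (w (inj₂ leaf₄)) (w (inj₂ (path j)))
  ... | just j | just k = solve 4
    (λ a b c d →
      comb (skew (tot (a ∷ b ∷ [])) (tot (c ∷ d ∷ []))) :=
      tot (comb (skew a c) ∷ comb (skew b d) ∷ []))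
    refl (w (inj₂ (spine j))) (w (inj₂ (spine k))) (w (inj₂ (path j))) (w (inj₂ (path k)))
  switch-intertwines (inj₂ (spine i)) with before i | after i
  ... | nothing | nothing = solve 6
    (λ a b c d e f →
      comb (plus (tot (a ∷ b ∷ [])) (tot (a ∷ b ∷ []))) :=
      tot (comb (shift a c d) ∷ comb (shift a d c) ∷ comb (shift b e f) ∷ comb (shift b f e) ∷ []))
    refl (w (inj₁ bottom)) (w (inj₁ top)) (w (inj₂ leaf₁)) (w (inj₂ leaf₂)) (w (inj₂ leaf₃)) (w (inj₂ leaf₄))
  ... | nothing | just k = solve 5
    (λ a b c d e →
      comb (plus (tot (a ∷ b ∷ [])) (tot (a ∷ c ∷ []))) :=
      tot (comb (shift a d e) ∷ comb (shift a e d) ∷ comb (plus b c) ∷ []))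
    refl (w (inj₁ bottom)) (w (inj₁ (left k))) (w (inj₁ (right k))) (w (inj₂ leaf₁)) (w (inj₂ leaf₂))
  ... | just j | nothing = solve 5
    (λ a b c d e →
      comb (plus (tot (a ∷ b ∷ [])) (tot (c ∷ b ∷ []))) :=
      tot (comb (plus a c) ∷ comb (shift b d e) ∷ comb (shift b e d) ∷ []))
    refl (w (inj₁ (left j))) (w (inj₁ top)) (w (inj₁ (right j))) (w (inj₂ leaf₃)) (w (inj₂ leaf₄))
  ... | just j | just k = solve 4
    (λ a b c d →
      comb (plus (tot (a ∷ b ∷ [])) (tot (c ∷ d ∷ []))) :=
      tot (comb (plus a c) ∷ comb (plus b d) ∷ []))
    refl (w (inj₁ (left j))) (w (inj₁ (left k))) (w (inj₁ (right j))) (w (inj₁ (right k)))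
  switch-intertwines (inj₂ (path i)) with before i | after i
  ... | nothing | nothing = solve 2
    (λ a b → comb (minus (tot (a ∷ b ∷ [])) (tot (a ∷ b ∷ []))) := tot ([]))
    refl (w (inj₁ bottom)) (w (inj₁ top))
  ... | nothing | just k = solve 3
    (λ a b c →
      comb (minus (tot (a ∷ b ∷ [])) (tot (a ∷ c ∷ []))) :=
      tot (comb (minus b c) ∷ []))
    refl (w (inj₁ bottom)) (w (inj₁ (left k))) (w (inj₁ (right k)))
  ... | just j | nothing = solve 3
    (λ a b c →
      comb (minus (tot (a ∷ b ∷ [])) (tot (c ∷ b ∷ []))) :=
      tot (comb (minus a c) ∷ []))
    refl (w (inj₁ (left j))) (w (inj₁ top)) (w (inj₁ (right j)))
  ... | just j | just k = solve 4
    (λ a b c d →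
      comb (minus (tot (a ∷ b ∷ [])) (tot (c ∷ d ∷ []))) :=
      tot (comb (minus a c) ∷ comb (minus b d) ∷ []))
    refl (w (inj₁ (left j))) (w (inj₁ (left k))) (w (inj₁ (right j))) (w (inj₁ (right k)))

-- Finiteness of the node sets.

Finite : Set → Set
Finite X = ∃[ N ] (Fin N ↔ X)

finite-⊎ : ∀ {X Y} → Finite X → Finite Y → Finite (X ⊎ Y)
finite-⊎ (M , f) (N , g) = M ℕ.+ N , ↔-trans Fin.+↔⊎ (f ⊎-↔ g)

cyclic-finite : ∀ ℓ → Finite (Cyclic ℓ)
cyclic-finite ℓ = 2 ℕ.+ (suc ℓ ℕ.+ suc ℓ) ,
  ↔-trans Fin.+↔⊎ (↔-trans (↔-refl ⊎-↔ Fin.+↔⊎) (mk↔ₛ′ to from to∘from from∘to))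
  where
  to : Fin 2 ⊎ (Fin (suc ℓ) ⊎ Fin (suc ℓ)) → Cyclic ℓ
  to (inj₁ 0F)       = bottom
  to (inj₁ 1F)       = top
  to (inj₂ (inj₁ i)) = left i
  to (inj₂ (inj₂ i)) = right i

  from : Cyclic ℓ → Fin 2 ⊎ (Fin (suc ℓ) ⊎ Fin (suc ℓ))
  from bottom    = inj₁ 0F
  from top       = inj₁ 1F
  from (left i)  = inj₂ (inj₁ i)
  from (right i) = inj₂ (inj₂ i)

  to∘from : ∀ u → to (from u) ≡ u
  to∘from bottom    = refl
  to∘from top       = refl
  to∘from (left _)  = refl
  to∘from (right _) = refl

  from∘to : ∀ x → from (to x) ≡ x
  from∘to (inj₁ 0F)       = refl
  from∘to (inj₁ 1F)       = refl
  from∘to (inj₂ (inj₁ _)) = refl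
  from∘to (inj₂ (inj₂ _)) = refl

forest-finite : ∀ ℓ → Finite (Forest ℓ)
forest-finite ℓ = 4 ℕ.+ (suc ℓ ℕ.+ suc ℓ) ,
  ↔-trans Fin.+↔⊎ (↔-trans (↔-refl ⊎-↔ Fin.+↔⊎) (mk↔ₛ′ to from to∘from from∘to))
  where
  to : Fin 4 ⊎ (Fin (suc ℓ) ⊎ Fin (suc ℓ)) → Forest ℓ
  to (inj₁ 0F)       = leaf₁
  to (inj₁ 1F)       = leaf₂
  to (inj₁ 2F)       = leaf₃
  to (inj₁ 3F)       = leaf₄
  to (inj₂ (inj₁ i)) = spine i
  to (inj₂ (inj₂ i)) = path i

  from : Forest ℓ → Fin 4 ⊎ (Fin (suc ℓ) ⊎ Fin (suc ℓ))
  from leaf₁     = inj₁ 0F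
  from leaf₂     = inj₁ 1F
  from leaf₃     = inj₁ 2F
  from leaf₄     = inj₁ 3F
  from (spine i) = inj₂ (inj₁ i)
  from (path i)  = inj₂ (inj₂ i)

  to∘from : ∀ u → to (from u) ≡ u
  to∘from leaf₁     = refl
  to∘from leaf₂     = refl
  to∘from leaf₃     = refl
  to∘from leaf₄     = refl
  to∘from (spine _) = refl
  to∘from (path _)  = refl

  from∘to : ∀ x → from (to x) ≡ x
  from∘to (inj₁ 0F)       = refl
  from∘to (inj₁ 1F)       = refl
  from∘to (inj₁ 2F)       = refl
  from∘to (inj₁ 3F)       = refl
  from∘to (inj₂ (inj₁ _)) = refl
  from∘to (inj₂ (inj₂ _)) = refl

-- Matching sides and degrees.

module _ {n : ℕ} where
  private
    X = cyclicGraph (1 ℕ.+ n) ⊎ᶠ forest (3 ℕ.+ n)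
    Y = cyclicGraph (3 ℕ.+ n) ⊎ᶠ forest (1 ℕ.+ n)

  -- Not a graph morphism: moving two spine and two path nodes into the cycle
  -- is enough for the degree sequences, which only see sides and degrees.
  regroup : Node X → Node Y
  regroup (inj₁ bottom)                        = inj₁ bottom
  regroup (inj₁ top)                           = inj₁ top
  regroup (inj₁ (left i))                      = inj₁ (left (suc (suc i)))
  regroup (inj₁ (right i))                     = inj₁ (right (suc (suc i)))
  regroup (inj₂ leaf₁)                         = inj₂ leaf₁
  regroup (inj₂ leaf₂)                         = inj₂ leaf₂
  regroup (inj₂ leaf₃)                         = inj₂ leaf₃
  regroup (inj₂ leaf₄)                         = inj₂ leaf₄
  regroup (inj₂ (spine 0F))                    = inj₂ (spine 0F)
  regroup (inj₂ (spine 1F))                    = inj₁ (left 1F)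
  regroup (inj₂ (spine 2F))                    = inj₁ (left 0F)
  regroup (inj₂ (spine (suc (suc (suc i)))))   = inj₂ (spine (suc i))
  regroup (inj₂ (path 0F))                     = inj₂ (path 0F)
  regroup (inj₂ (path 1F))                     = inj₁ (right 1F)
  regroup (inj₂ (path 2F))                     = inj₁ (right 0F)
  regroup (inj₂ (path (suc (suc (suc i)))))    = inj₂ (path (suc i))

  regroup⁻ : Node Y → Node X
  regroup⁻ (inj₁ bottom)                  = inj₁ bottom
  regroup⁻ (inj₁ top)                     = inj₁ top
  regroup⁻ (inj₁ (left 0F))               = inj₂ (spine 2F)
  regroup⁻ (inj₁ (left 1F))               = inj₂ (spine 1F)
  regroup⁻ (inj₁ (left (suc (suc i))))    = inj₁ (left i)
  regroup⁻ (inj₁ (right 0F))              = inj₂ (path 2F)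
  regroup⁻ (inj₁ (right 1F))              = inj₂ (path 1F)
  regroup⁻ (inj₁ (right (suc (suc i))))   = inj₁ (right i)
  regroup⁻ (inj₂ leaf₁)                   = inj₂ leaf₁
  regroup⁻ (inj₂ leaf₂)                   = inj₂ leaf₂
  regroup⁻ (inj₂ leaf₃)                   = inj₂ leaf₃
  regroup⁻ (inj₂ leaf₄)                   = inj₂ leaf₄
  regroup⁻ (inj₂ (spine 0F))              = inj₂ (spine 0F)
  regroup⁻ (inj₂ (spine (suc i)))         = inj₂ (spine (suc (suc (suc i))))
  regroup⁻ (inj₂ (path 0F))               = inj₂ (path 0F)
  regroup⁻ (inj₂ (path (suc i)))          = inj₂ (path (suc (suc (suc i))))

  regroup-regroup⁻ : ∀ y → regroup (regroup⁻ y) ≡ y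
  regroup-regroup⁻ (inj₁ bottom)                = refl
  regroup-regroup⁻ (inj₁ top)                   = refl
  regroup-regroup⁻ (inj₁ (left 0F))             = refl
  regroup-regroup⁻ (inj₁ (left 1F))             = refl
  regroup-regroup⁻ (inj₁ (left (suc (suc _))))  = refl
  regroup-regroup⁻ (inj₁ (right 0F))            = refl
  regroup-regroup⁻ (inj₁ (right 1F))            = refl
  regroup-regroup⁻ (inj₁ (right (suc (suc _)))) = refl
  regroup-regroup⁻ (inj₂ leaf₁)                 = refl
  regroup-regroup⁻ (inj₂ leaf₂)                 = refl
  regroup-regroup⁻ (inj₂ leaf₃)                 = refl
  regroup-regroup⁻ (inj₂ leaf₄)                 = refl
  regroup-regroup⁻ (inj₂ (spine 0F))            = refl
  regroup-regroup⁻ (inj₂ (spine (suc _)))       = refl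
  regroup-regroup⁻ (inj₂ (path 0F))             = refl
  regroup-regroup⁻ (inj₂ (path (suc _)))        = refl

  regroup⁻-regroup : ∀ x → regroup⁻ (regroup x) ≡ x
  regroup⁻-regroup (inj₁ bottom)                      = refl
  regroup⁻-regroup (inj₁ top)                         = refl
  regroup⁻-regroup (inj₁ (left _))                    = refl
  regroup⁻-regroup (inj₁ (right _))                   = refl
  regroup⁻-regroup (inj₂ leaf₁)                       = refl
  regroup⁻-regroup (inj₂ leaf₂)                       = refl
  regroup⁻-regroup (inj₂ leaf₃)                       = refl
  regroup⁻-regroup (inj₂ leaf₄)                       = refl
  regroup⁻-regroup (inj₂ (spine 0F))                  = refl
  regroup⁻-regroup (inj₂ (spine 1F))                  = refl
  regroup⁻-regroup (inj₂ (spine 2F))                  = refl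
  regroup⁻-regroup (inj₂ (spine (suc (suc (suc _))))) = refl
  regroup⁻-regroup (inj₂ (path 0F))                   = refl
  regroup⁻-regroup (inj₂ (path 1F))                   = refl
  regroup⁻-regroup (inj₂ (path 2F))                   = refl
  regroup⁻-regroup (inj₂ (path (suc (suc (suc _)))))  = refl

  -- All other indexed nodes keep their index or move by two, which preserves the colour. For the
  -- same reason the nodes 1 and 2 of spine and path enter the cycle in reverse order, at the
  -- indices 1 and 0.
  regroup-side : ∀ x → side Y (regroup x) ≡ side X x
  regroup-side (inj₁ bottom)                      = refl
  regroup-side (inj₁ top)                         = not-involutive _
  regroup-side (inj₁ (left _))                    = not-involutive _
  regroup-side (inj₁ (right _))                   = not-involutive _
  regroup-side (inj₂ leaf₁)                       = refl
  regroup-side (inj₂ leaf₂)                       = refl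
  regroup-side (inj₂ leaf₃)                       = sym (not-involutive _)
  regroup-side (inj₂ leaf₄)                       = sym (not-involutive _)
  regroup-side (inj₂ (spine 0F))                  = refl
  regroup-side (inj₂ (spine 1F))                  = refl
  regroup-side (inj₂ (spine 2F))                  = refl
  regroup-side (inj₂ (spine (suc (suc (suc _))))) = sym (not-involutive _)
  regroup-side (inj₂ (path 0F))                   = refl
  regroup-side (inj₂ (path 1F))                   = refl
  regroup-side (inj₂ (path 2F))                   = refl
  regroup-side (inj₂ (path (suc (suc (suc _)))))  = sym (not-involutive _)

  -- The moved nodes are inner nodes of spine or path and have degree 2, like every node of a cycle.
  -- Both spines have at least two nodes, so their ends have degree 3 in either graph.
  regroup-degree : ∀ x → length (neighbours Y (regroup x)) ≡ length (neighbours X x)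
  regroup-degree (inj₁ bottom)     = refl
  regroup-degree (inj₁ top)        = refl
  regroup-degree (inj₁ (left _))   = refl
  regroup-degree (inj₁ (right _))  = refl
  regroup-degree (inj₂ leaf₁)      = refl
  regroup-degree (inj₂ leaf₂)      = refl
  regroup-degree (inj₂ leaf₃)      = refl
  regroup-degree (inj₂ leaf₄)      = refl
  regroup-degree (inj₂ (spine 0F)) = refl
  regroup-degree (inj₂ (spine 1F)) = refl
  regroup-degree (inj₂ (spine 2F)) = refl
  regroup-degree (inj₂ (spine (suc (suc (suc i))))) with after i
  ... | nothing = refl
  ... | just _  = refl
  regroup-degree (inj₂ (path 0F))  = refl
  regroup-degree (inj₂ (path 1F))  = refl
  regroup-degree (inj₂ (path 2F))  = refl
  regroup-degree (inj₂ (path (suc (suc (suc i))))) with after i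
  ... | nothing = refl
  ... | just _  = refl

  regroup-↔ : Node X ↔ Node Y
  regroup-↔ = mk↔ₛ′ regroup regroup⁻ regroup-regroup⁻ regroup⁻-regroup

switching : ∀ n m → (cyclicGraph n ⊎ᶠ forest m) ⇝ (cyclicGraph m ⊎ᶠ forest n)
switching n m = record { rows = switch ; intertwines = switch-intertwines }

-- The assembled graph: irregularity, cycles and girth.

module TwoCycles (a n m : ℕ) {N : ℕ} where
  F : Pseudoforest
  F = cyclicGraph a ⊎ᶠ cyclicGraph n ⊎ᶠ forest m

  module Realised (enum : Fin N ↔ Node F) where
    open Realise F enum public
    open Graph G
    open Cycle
    open Oriented G (λ i j → Pseudoforest._⟶_ F (name i) (name j))
      (λ p q → name-injective (Pseudoforest.functional F p q))
      (λ {i} → Pseudoforest.∈⇒⟶ F (name i))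

    degree-index : ∀ x → degree (index x) ≡ length (neighbours F x)
    degree-index x = trans (degree≡ (index x)) (cong (length ∘ neighbours F) (strictlyInverseˡ x))

    -- The leaf `leaf₁` and the node `bottom` of the first cycle lie on the same side, with degrees
    -- 1 and 2.
    irregular : Irregular B
    irregular biRegular = 1≢2 (trans (sym (degree-index leaf)) (trans
      (biRegular (index leaf) (index (inj₁ bottom))
        (trans (cong (side F) (strictlyInverseˡ leaf)) (cong (side F) (sym (strictlyInverseˡ (inj₁ bottom))))))
      (degree-index (inj₁ bottom))))
      where
      leaf : Node F
      leaf = inj₂ (inj₂ leaf₁)

      1≢2 : 1 ≢ 2
      1≢2 ()

    width : Bool → ℕ
    width false = a
    width true  = n

    embed : ∀ ι → Cyclic (width ι) → Node F
    embed false u = inj₁ u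
    embed true  u = inj₂ (inj₁ u)

    embed-injective : ∀ ι {u v} → embed ι u ≡ embed ι v → u ≡ v
    embed-injective false refl = refl
    embed-injective true  refl = refl

    embed-disjoint : ∀ ι κ {u v} → embed ι u ≡ embed κ v → ι ≡ κ
    embed-disjoint false false _ = refl
    embed-disjoint true  true  _ = refl

    embed-neighbour : ∀ ι u → embed ι (succ u) ∈ neighbours F (embed ι u)
    embed-neighbour false u = ∈-map⁺ inj₁ (succ-∈ u)
    embed-neighbour true  u = ∈-map⁺ inj₂ (∈-map⁺ inj₁ (succ-∈ u))

    ring : ∀ ι → Cycle G (circumference (width ι))
    ring ι = record
      { length≥3  = s≤s (s≤s (ℕ.m≤n⇒m≤o+n (width ι) (s≤s z≤n)))
      ; vertex    = λ k → index (embed ι (at (toℕ k)))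
      ; injective = λ {j} {k} eq → Fin.toℕ-injective (trans
          (sym (position-at (toℕ j) (Fin.toℕ<n j))) (trans
          (cong position (embed-injective ι (index-injective eq)))
          (position-at (toℕ k) (Fin.toℕ<n k))))
      ; adjacent  = λ k → subst₂ (λ u v → v ∈ neighbours F u)
          (sym (strictlyInverseˡ _))
          (sym (trans (strictlyInverseˡ _) (cong (embed ι) (at-next k))))
          (embed-neighbour ι (at (toℕ k)))
      }

    ∈-ring : ∀ ι u → index (embed ι u) ∈ᶜ ring ι
    ∈-ring ι u = fromℕ< (position< u) , cong (index ∘ embed ι)
      (sym (trans (cong at (Fin.toℕ-fromℕ< (position< u))) (at-position u)))

    rings-disjoint : ∀ {ι κ v} → v ∈ᶜ ring ι → v ∈ᶜ ring κ → ι ≡ κ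
    rings-disjoint {ι} {κ} (j , v≡) (k , v≡′) =
      embed-disjoint ι κ (index-injective (trans (sym v≡) v≡′))

    InForest : Node F → Set
    InForest x = ∃[ t ] x ≡ inj₂ (inj₂ t)

    inForest-closed : ∀ x {y} → y ∈ neighbours F x → InForest x → InForest y
    inForest-closed _ y∈ (t , refl) with Pseudoforest.∈⇒⟶ F (inj₂ (inj₂ t)) y∈
    ... | inj₁ (inj₂ (inj₂ _)) = _ , refl
    ... | inj₂ (inj₂ (inj₂ _)) = _ , refl

    height : Node F → ℕ
    height = [ (λ _ → 0) , [ (λ _ → 0) , depth ]′ ]′

    height-descends : ∀ {x y} → InForest x → Pseudoforest._⟶_ F x y → height y < height x
    height-descends (t , refl) (inj₂ (inj₂ p)) = depth-parent t p

    -- A node off the two rings belongs to the forest, where arcs strictly decrease the depth and no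
    -- cycle can pass.
    covered : ∀ {i} (C : Cycle G i) j → ∃[ ι ] vertex C j ∈ᶜ ring ι
    covered C j = go (name (vertex C j)) refl
      where
      onRing : ∀ ι u → name (vertex C j) ≡ embed ι u → vertex C j ∈ᶜ ring ι
      onRing ι u eq = subst (_∈ᶜ ring ι)
        (trans (cong index (sym eq)) (strictlyInverseʳ (vertex C j))) (∈-ring ι u)

      go : ∀ x → name (vertex C j) ≡ x → ∃[ ι ] vertex C j ∈ᶜ ring ι
      go (inj₁ u)        eq = false , onRing false u eq
      go (inj₂ (inj₁ u)) eq = true , onRing true u eq
      go (inj₂ (inj₂ t)) eq = ⊥-elim (acyclic (InForest ∘ name) (height ∘ name)
        (λ {u} → inForest-closed (name u)) (λ {u} {v} → height-descends {name u} {name v}) C j (t , eq))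

    open Count (circumference ∘ width) ring rings-disjoint covered public
      using (length≡; cycleCount)

    hasGirth : circumference a ≤ circumference n → HasGirth G (circumference a)
    hasGirth a≤n = ring false , λ i C → case length≡ C of λ where
      (false , refl) → ℕ.≤-refl
      (true  , refl) → a≤n

-- Cycle counts and the cospectral pair.

count-one : {A : Set} (x : A) → (∀ y → x ≡ y) → A ↔ Fin 1
count-one x unique = mk↔ₛ′ (λ _ → 0F) (λ _ → x) (λ { 0F → refl ; (suc ()) }) unique

count-none : {A : Set} → ¬ A → A ↔ Fin 0
count-none ¬A = mk↔ₛ′ (⊥-elim ∘ ¬A) (λ ()) (λ ()) (λ x → ⊥-elim (¬A x))

-- Counts the contribution of the common cycle to the i-cycles: 1 if i equals the girth, 0
-- otherwise. As both graphs share it, the case i = g needs no separate treatment.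
equation-count : ∀ x y → ∃[ c ] ((x ≡ y) ↔ Fin c)
equation-count x y with x ℕ.≟ y
... | yes eq = 1 , count-one eq (ℕ.≡-irrelevant eq)
... | no neq = 0 , count-none neq

∃Bool↔⊎ : {P : Bool → Set} → ∃ P ↔ (P false ⊎ P true)
∃Bool↔⊎ = mk↔ₛ′
  (λ { (false , p) → inj₁ p ; (true , p) → inj₂ p })
  (λ { (inj₁ p) → false , p ; (inj₂ p) → true , p })
  (λ { (inj₁ _) → refl ; (inj₂ _) → refl })
  (λ { (false , _) → refl ; (true , _) → refl })

∃Bool-count : ∀ {P : Bool → Set} {c d} → P false ↔ Fin c → P true ↔ Fin d → ∃ P ↔ Fin (c ℕ.+ d)
∃Bool-count f g = ↔-trans ∃Bool↔⊎ (↔-trans (f ⊎-↔ g) (↔-sym Fin.+↔⊎))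

circumference-mono-< : ∀ {m n} → m < n → circumference m < circumference n
circumference-mono-< m<n = ℕ.+-mono-< (ℕ.+-monoʳ-< 2 m<n) (ℕ.+-monoʳ-< 2 m<n)

module Pair (a n : ℕ) (a≤n : circumference a ≤ circumference (1 ℕ.+ n)) where
  private
    finite = finite-⊎ (cyclic-finite a)
      (finite-⊎ (cyclic-finite (1 ℕ.+ n)) (forest-finite (3 ℕ.+ n)))
    N = proj₁ finite

    enum : Fin N ↔ Node (TwoCycles.F a (1 ℕ.+ n) (3 ℕ.+ n) {N})
    enum = proj₂ finite

    enum′ : Fin N ↔ Node (TwoCycles.F a (3 ℕ.+ n) (1 ℕ.+ n) {N})
    -- The second graph is numbered through the regrouping, so that vertices with the same number
    -- agree in side and degree.
    enum′ = ↔-trans enum (↔-refl ⊎-↔ regroup-↔)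

  module H  = TwoCycles.Realised a (1 ℕ.+ n) (3 ℕ.+ n) enum
  module H′ = TwoCycles.Realised a (3 ℕ.+ n) (1 ℕ.+ n) enum′

  H H′ : BipartiteGraph
  H  = H.B
  H′ = H′.B

  private
    F  = TwoCycles.F a (1 ℕ.+ n) (3 ℕ.+ n) {N}
    F′ = TwoCycles.F a (3 ℕ.+ n) (1 ℕ.+ n) {N}

    C  = cyclicGraph a
    X  = cyclicGraph (1 ℕ.+ n) ⊎ᶠ forest (3 ℕ.+ n)
    X′ = cyclicGraph (3 ℕ.+ n) ⊎ᶠ forest (1 ℕ.+ n)

    regroup₊ : Node F → Node F′
    regroup₊ = Inverse.to (↔-refl ⊎-↔ regroup-↔)

    regroup₊-side : ∀ x → side F′ (regroup₊ x) ≡ side F x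
    regroup₊-side (inj₁ _) = refl
    regroup₊-side (inj₂ x) = regroup-side x

    regroup₊-degree : ∀ x → length (neighbours F′ (regroup₊ x)) ≡ length (neighbours F x)
    regroup₊-degree (inj₁ u) =
      trans (length-neighbours-inj₁ C X′ u) (sym (length-neighbours-inj₁ C X u))
    regroup₊-degree (inj₂ x) = trans (length-neighbours-inj₂ C X′ (regroup x))
      (trans (regroup-degree x) (sym (length-neighbours-inj₂ C X x)))

  longer : circumference (1 ℕ.+ n) < circumference (3 ℕ.+ n)
  longer = circumference-mono-< (ℕ.m<n⇒m<1+n (ℕ.n<1+n (1 ℕ.+ n)))

  cospectral-pair : Cospectral (graph H) (graph H′)
  cospectral-pair = cospectral enum enum′
    (beside (cyclicGraph a) (switching (1 ℕ.+ n) (3 ℕ.+ n)))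
    (beside (cyclicGraph a) (switching (3 ℕ.+ n) (1 ℕ.+ n)))
    (beside-inverse (cyclicGraph a) (switching (1 ℕ.+ n) (3 ℕ.+ n)) (switching (3 ℕ.+ n) (1 ℕ.+ n))
      switch-involutive)
    (beside-inverse (cyclicGraph a) (switching (3 ℕ.+ n) (1 ℕ.+ n)) (switching (1 ℕ.+ n) (3 ℕ.+ n))
      switch-involutive)

  -- By the choice of `enum′` the lists of degrees coincide entry by entry even before sorting.
  same-degrees : SameDegreeSequences H H′
  same-degrees s = cong sort (trans
    (map-cong (λ v → trans (H.degree≡ v) (trans (sym (regroup₊-degree (H.name v))) (sym (H′.degree≡ v)))) _)
    (cong (map (Graph.degree (graph H′))) (filter-≐
      (λ v → BipartiteGraph.side H v Bool.≟ s) (λ v → BipartiteGraph.side H′ v Bool.≟ s)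
      ((λ {v} → trans (regroup₊-side (H.name v))) , (λ {v} → trans (sym (regroup₊-side (H.name v)))))
      (allFin N))))
    where open Data.List.Sort (Flip.decTotalOrder ℕ.≤-decTotalOrder) using (sort)

  different : DifferentCycleCounts (graph H) (graph H′) (circumference (1 ℕ.+ n))
  -- The exchanged cycle contributes 1 in `H`, where its length is i, and 0 in `H′`, where it is
  -- longer.
  different = let c , a≡n = equation-count (circumference a) (circumference (1 ℕ.+ n)) in
    c ℕ.+ 1 , c ℕ.+ 0 ,
    H.cycleCount (∃Bool-count a≡n (count-one refl (ℕ.≡-irrelevant refl))) ,
    H′.cycleCount (∃Bool-count a≡n (count-none (ℕ.<⇒≢ longer ∘ sym))) ,
    λ eq → case ℕ.+-cancelˡ-≡ c 1 0 eq of λ ()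

  girth : HasGirth (graph H) (circumference a)
  girth = H.hasGirth a≤n

  girth′ : HasGirth (graph H′) (circumference a)
  girth′ = H′.hasGirth (ℕ.≤-trans a≤n
    (ℕ.<⇒≤ longer))

-- Here `circumference (1 + n)` is 2(3 + n), so half of g is 3 + n; smaller halves contradict the
-- bound 6.
even⇒circumference : ∀ {g} → 2 ∣ g → 6 ≤ g → ∃[ n ] circumference (1 ℕ.+ n) ≡ g
even⇒circumference (divides zero refl) ()
even⇒circumference (divides 1 refl) (s≤s (s≤s ()))
even⇒circumference (divides 2 refl) (s≤s (s≤s (s≤s (s≤s ()))))
even⇒circumference (divides q@(suc (suc (suc n))) refl) _ =
  n , trans (cong (q ℕ.+_) (sym (ℕ.+-identityʳ q))) (ℕ.*-comm 2 q)

mainTheorem4 : ∀ (g : ℕ) → 2 ∣ g → 8 ≤ g →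
    (∀ (i : ℕ) → 2 ∣ i → g ≤ i →
    Σ[ H ∈ BipartiteGraph ] Σ[ H′ ∈ BipartiteGraph ]
    ( Irregular H × Irregular H′
    × Cospectral (graph H) (graph H′)
    × SameDegreeSequences H H′
    × HasGirth (graph H) g × HasGirth (graph H′) g
    × DifferentCycleCounts (graph H) (graph H′) i ))
    × (∀ (i : ℕ) → 2 ∣ i → g ≤ i → ¬ CycleCountDetermined g i)
mainTheorem4 g 2∣g 8≤g = pair , undetermined
  where
  6≤g : 6 ≤ g
  6≤g = ℕ.≤-trans (ℕ.m≤m+n 6 2) 8≤g

  pair : ∀ (i : ℕ) → 2 ∣ i → g ≤ i →
    Σ[ H ∈ BipartiteGraph ] Σ[ H′ ∈ BipartiteGraph ]
    ( Irregular H × Irregular H′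
    × Cospectral (graph H) (graph H′)
    × SameDegreeSequences H H′
    × HasGirth (graph H) g × HasGirth (graph H′) g
    × DifferentCycleCounts (graph H) (graph H′) i )
  pair i 2∣i g≤i
    with a , refl ← even⇒circumference 2∣g 6≤g
       | n , refl ← even⇒circumference 2∣i (ℕ.≤-trans 6≤g g≤i) =
    H , H′ , H.irregular , H′.irregular , cospectral-pair , same-degrees , girth , girth′ , different
    -- `Pair` expects the full index of the common cycle but adds 1 to that of the exchanged one,
    -- hence `1 + a` beside `n`.
    where open Pair (1 ℕ.+ a) n g≤i

  undetermined : ∀ (i : ℕ) → 2 ∣ i → g ≤ i → ¬ CycleCountDetermined g i
  undetermined i 2∣i g≤i determined with pair i 2∣i g≤i
  ... | H , H′ , irr , irr′ , cosp , degs , girth , girth′ , _ , _ , count , count′ , N≢N′ =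
    N≢N′ (determined H H′ irr irr′ girth girth′ cosp degs count count′)
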